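{- The Prime $k$-tuples Conjecture implies that there are infinitely many Lucas-Carmichael integers of degree $2$ with exactly three prime factors.
   Context: A Lucas-Carmichael integer is a square-free positive composite integer $n$ such that $p+1 \mid n+1$ for every prime $p$ dividing $n$. For an integer $b\ge 2$ and a positive integer $N$, $S_b(N)$ denotes the sum of the base-$b$ digits of $N$. The degree of a Lucas-Carmichael integer $n$ is the integer $\alpha = \max_{p\mid n} \frac{S_{p+2}(n+2)-1}{p+1}$, the maximum being over the prime divisors $p$ of $n$. Prime $k$-tuples Conjecture: Let $a_1,\ldots,a_k$ be positive integers, and let $b_1,\ldots,b_k$ be nonzero integers. For $m\ge 1$, define $f(m)=\prod_{i=1}^k (a_i m+b_i)$. Let $P(x)$ denote the number of positive integers $m\le x$ for which $a_i m+b_i$ is prime for each $i=1,\ldots,k$. The conjecture states that if no prime divides $f(m)$ for every $m$, then there exists $c>0$ such that $P(x)\sim \frac{cx}{\log^k x}$ as $x\to\infty$. -}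

module Defs where

open import Data.Digit using (toDigits)
open import Data.Empty using (⊥)
open import Data.Fin.Base as Fin using (Fin)
import Data.Fin.Properties as Fin
open import Data.Integer.Base as ℤ using (ℤ)
import Data.Integer.Divisibility as ℤ
import Data.Integer.Properties as ℤ
open import Data.List.Base using (List; map; filter; length; upTo)
open import Data.List.Extrema.Nat using (max)
open import Data.Nat.Base as ℕ using (ℕ; zero; suc)
open import Data.Nat.Divisibility using (_∣_; _∣?_)
import Data.Nat.Properties as ℕ
open import Data.Nat.ListAction using (sum)
open import Data.Nat.Primality using (Prime; prime?; Composite)
open import Data.Product.Base using (∃; ∃-syntax; _×_; _,_; proj₁; proj₂)
open import Data.Rational.Base as ℚ using (ℚ; 0ℚ; 1ℚ)
import Data.Rational.Properties as ℚ
open import Data.Rational.Solver using (module +-*-Solver)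
import Data.Rational.Unnormalised.Base as ℚᵘ
import Data.Rational.Unnormalised.Properties as ℚᵘ
open import Data.Sum.Base using (_⊎_; inj₁; inj₂)
import Data.Vec.Functional as Vector
open import Relation.Binary.PropositionalEquality
  using (_≡_; _≢_; refl; sym; trans; cong; cong₂; subst; subst₂)
open import Relation.Nullary using (¬_; Dec; yes; no; contradiction; _×-dec_)
open import Relation.Nullary.Decidable using (True)

fromℕℚ : ℕ → ℚ
fromℕℚ n = ℤ.+ n ℚ./ 1

-- Total, with the junk value 0 at 0, so that sequences can be inverted pointwise.
recip : ℚ → ℚ
recip p with p ℚ.≟ 0ℚ
... | yes _   = 0ℚ
... | no p≢0 = (ℚ.1/ p) {{ℚ.≢-nonZero p≢0}}

open import Algebra.Definitions.RawSemiring ℚ.+-*-rawSemiring public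
  using () renaming (_^_ to _^ℚ_)

module ℚ-Lemmas where
  open import Data.Rational.Base using (_+_; _*_; _-_; -_; ∣_∣; _≤_; _<_)
  open ℚ.≤-Reasoning
  open +-*-Solver using (solve; _:=_; _:+_; _:*_; _:-_; :-_; con)

  0≤1 : 0ℚ ≤ 1ℚ
  0≤1 = ℚ.nonNegative⁻¹ 1ℚ

  0<1 : 0ℚ < 1ℚ
  0<1 = ℚ.positive⁻¹ 1ℚ

  0<½ : 0ℚ < ℚ.½
  0<½ = ℚ.positive⁻¹ ℚ.½

  *-monoʳ : ∀ {p q} r → 0ℚ ≤ r → p ≤ q → p * r ≤ q * r
  *-monoʳ r 0≤r = ℚ.*-monoʳ-≤-nonNeg r {{ℚ.nonNegative 0≤r}}

  *-monoˡ : ∀ {p q} r → 0ℚ ≤ r → p ≤ q → r * p ≤ r * q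
  *-monoˡ r 0≤r = ℚ.*-monoˡ-≤-nonNeg r {{ℚ.nonNegative 0≤r}}

  0≤* : ∀ {p q} → 0ℚ ≤ p → 0ℚ ≤ q → 0ℚ ≤ p * q
  0≤* {p} {q} 0≤p 0≤q = ℚ.nonNegative⁻¹ (p * q)
    {{ℚ.nonNeg*nonNeg⇒nonNeg p {{ℚ.nonNegative 0≤p}} q {{ℚ.nonNegative 0≤q}}}}

  0<* : ∀ {p q} → 0ℚ < p → 0ℚ < q → 0ℚ < p * q
  0<* {p} {q} 0<p 0<q = ℚ.positive⁻¹ (p * q)
    {{ℚ.pos*pos⇒pos p {{ℚ.positive 0<p}} q {{ℚ.positive 0<q}}}}

  0≤+ : ∀ {p q} → 0ℚ ≤ p → 0ℚ ≤ q → 0ℚ ≤ p + q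
  0≤+ = ℚ.+-mono-≤

  0<+ : ∀ {p q} → 0ℚ < p → 0ℚ ≤ q → 0ℚ < p + q
  0<+ = ℚ.+-mono-<-≤

  *-mono : ∀ {p p′ q q′} → 0ℚ ≤ q → 0ℚ ≤ p′ → p ≤ p′ → q ≤ q′ → p * q ≤ p′ * q′
  *-mono {p} {p′} {q} {q′} 0≤q 0≤p′ p≤p′ q≤q′ =
    ℚ.≤-trans (*-monoʳ q 0≤q p≤p′) (*-monoˡ p′ 0≤p′ q≤q′)

  neg-neg : ∀ p → - (- p) ≡ p
  neg-neg = solve 1 (λ p → :- (:- p) := p) refl

  p≤∣p∣ : ∀ p → p ≤ ∣ p ∣
  p≤∣p∣ p with ℚ.≤-total 0ℚ p
  ... | inj₁ 0≤p = ℚ.≤-reflexive (sym (ℚ.0≤p⇒∣p∣≡p 0≤p))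
  ... | inj₂ p≤0 = ℚ.≤-trans p≤0 (ℚ.0≤∣p∣ p)

  -p≤∣p∣ : ∀ p → - p ≤ ∣ p ∣
  -p≤∣p∣ p = subst (- p ≤_) (ℚ.∣-p∣≡∣p∣ p) (p≤∣p∣ (- p))

  ∣p∣≤ : ∀ {p e} → p ≤ e → - p ≤ e → ∣ p ∣ ≤ e
  ∣p∣≤ {p} {e} p≤e -p≤e with ℚ.∣p∣≡p∨∣p∣≡-p p
  ... | inj₁ eq = subst (_≤ e) (sym eq) p≤e
  ... | inj₂ eq = subst (_≤ e) (sym eq) -p≤e

  ∣-∣-swap : ∀ p q → ∣ p - q ∣ ≡ ∣ q - p ∣
  ∣-∣-swap p q = trans (sym (ℚ.∣-p∣≡∣p∣ (p - q)))
    (cong ∣_∣ (solve 2 (λ p q → :- (p :- q) := q :- p) refl p q))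

  triangle : ∀ p q r → ∣ p - r ∣ ≤ ∣ p - q ∣ + ∣ q - r ∣
  triangle p q r = begin
    ∣ p - r ∣              ≡⟨ cong ∣_∣ (solve 3 (λ p q r → p :- r := (p :- q) :+ (q :- r)) refl p q r) ⟩
    ∣ (p - q) + (q - r) ∣  ≤⟨ ℚ.∣p+q∣≤∣p∣+∣q∣ (p - q) (q - r) ⟩
    ∣ p - q ∣ + ∣ q - r ∣  ∎

  ∣p∣-∣q∣≤∣p-q∣ : ∀ p q → ∣ p ∣ - ∣ q ∣ ≤ ∣ p - q ∣
  ∣p∣-∣q∣≤∣p-q∣ p q = begin
    ∣ p ∣ - ∣ q ∣                ≡⟨ cong (λ z → ∣ z ∣ - ∣ q ∣) (solve 2 (λ p q → p := (p :- q) :+ q) refl p q) ⟩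
    ∣ (p - q) + q ∣ - ∣ q ∣      ≤⟨ ℚ.+-monoˡ-≤ (- ∣ q ∣) (ℚ.∣p+q∣≤∣p∣+∣q∣ (p - q) q) ⟩
    ∣ p - q ∣ + ∣ q ∣ - ∣ q ∣    ≡⟨ solve 2 (λ a b → (a :+ b) :- b := a) refl ∣ p - q ∣ ∣ q ∣ ⟩
    ∣ p - q ∣                    ∎

  ∣∣p∣-∣q∣∣≤∣p-q∣ : ∀ p q → ∣ ∣ p ∣ - ∣ q ∣ ∣ ≤ ∣ p - q ∣
  ∣∣p∣-∣q∣∣≤∣p-q∣ p q = ∣p∣≤ (∣p∣-∣q∣≤∣p-q∣ p q) (begin
    - (∣ p ∣ - ∣ q ∣)  ≡⟨ solve 2 (λ a b → :- (a :- b) := b :- a) refl ∣ p ∣ ∣ q ∣ ⟩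
    ∣ q ∣ - ∣ p ∣      ≤⟨ ∣p∣-∣q∣≤∣p-q∣ q p ⟩
    ∣ q - p ∣          ≡⟨ ∣-∣-swap q p ⟩
    ∣ p - q ∣          ∎)

  *-lipschitz : ∀ {B C} a b c d → 0ℚ ≤ B → 0ℚ ≤ C → ∣ a ∣ ≤ B → ∣ d ∣ ≤ C →
                ∣ a * b - c * d ∣ ≤ (B + C) * (∣ a - c ∣ + ∣ b - d ∣)
  *-lipschitz {B} {C} a b c d 0≤B 0≤C a≤B d≤C = begin
    ∣ a * b - c * d ∣
      ≡⟨ cong ∣_∣ (solve 4 (λ a b c d → a :* b :- c :* d := a :* (b :- d) :+ d :* (a :- c)) refl a b c d) ⟩
    ∣ a * (b - d) + d * (a - c) ∣
      ≤⟨ ℚ.∣p+q∣≤∣p∣+∣q∣ (a * (b - d)) (d * (a - c)) ⟩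
    ∣ a * (b - d) ∣ + ∣ d * (a - c) ∣
      ≡⟨ cong₂ _+_ (ℚ.∣p*q∣≡∣p∣*∣q∣ a (b - d)) (ℚ.∣p*q∣≡∣p∣*∣q∣ d (a - c)) ⟩
    ∣ a ∣ * ∣ b - d ∣ + ∣ d ∣ * ∣ a - c ∣
      ≤⟨ ℚ.+-mono-≤ (*-mono (ℚ.0≤∣p∣ (b - d)) 0≤B+C a≤B+C (ℚ.≤-refl {∣ b - d ∣}))
                    (*-mono (ℚ.0≤∣p∣ (a - c)) 0≤B+C d≤B+C (ℚ.≤-refl {∣ a - c ∣})) ⟩
    (B + C) * ∣ b - d ∣ + (B + C) * ∣ a - c ∣
      ≡⟨ ℚ.+-comm ((B + C) * ∣ b - d ∣) ((B + C) * ∣ a - c ∣) ⟩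
    (B + C) * ∣ a - c ∣ + (B + C) * ∣ b - d ∣
      ≡⟨ ℚ.*-distribˡ-+ (B + C) ∣ a - c ∣ ∣ b - d ∣ ⟨
    (B + C) * (∣ a - c ∣ + ∣ b - d ∣) ∎
    where
    0≤B+C = 0≤+ 0≤B 0≤C
    a≤B+C : ∣ a ∣ ≤ B + C
    a≤B+C = subst (_≤ B + C) (ℚ.+-identityʳ ∣ a ∣) (ℚ.+-mono-≤ a≤B 0≤C)
    d≤B+C : ∣ d ∣ ≤ B + C
    d≤B+C = subst (_≤ B + C) (ℚ.+-identityˡ ∣ d ∣) (ℚ.+-mono-≤ 0≤B d≤C)

  recip-inverse : ∀ {p} → 0ℚ < p → p * recip p ≡ 1ℚ
  recip-inverse {p} 0<p with p ℚ.≟ 0ℚ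
  ... | yes p≡0 = contradiction (sym p≡0) (ℚ.<⇒≢ 0<p)
  ... | no p≢0  = ℚ.*-inverseʳ p {{ℚ.≢-nonZero p≢0}}

  0<recip : ∀ {p} → 0ℚ < p → 0ℚ < recip p
  0<recip {p} 0<p with p ℚ.≟ 0ℚ
  ... | yes p≡0 = contradiction (sym p≡0) (ℚ.<⇒≢ 0<p)
  ... | no p≢0  = ℚ.positive⁻¹ _ {{ℚ.1/pos⇒pos p {{ℚ.positive 0<p}}}}

  recip-antimono : ∀ {p q} → 0ℚ < p → p ≤ q → recip q ≤ recip p
  recip-antimono {p} {q} 0<p p≤q = begin
    recip q                      ≡⟨ ℚ.*-identityʳ _ ⟨
    recip q * 1ℚ                 ≡⟨ cong (recip q *_) (recip-inverse 0<p) ⟨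
    recip q * (p * recip p)      ≤⟨ *-monoˡ _ (ℚ.<⇒≤ (0<recip 0<q)) (*-monoʳ _ (ℚ.<⇒≤ (0<recip 0<p)) p≤q) ⟩
    recip q * (q * recip p)      ≡⟨ solve 3 (λ a b c → a :* (b :* c) := b :* a :* c) refl (recip q) q (recip p) ⟩
    q * recip q * recip p        ≡⟨ cong (_* recip p) (recip-inverse 0<q) ⟩
    1ℚ * recip p                 ≡⟨ ℚ.*-identityˡ _ ⟩
    recip p                      ∎
    where 0<q = ℚ.<-≤-trans 0<p p≤q

  recip-lipschitz : ∀ {δ p q} → 0ℚ < δ → δ ≤ p → δ ≤ q →
                    ∣ recip p - recip q ∣ ≤ recip δ * recip δ * ∣ p - q ∣
  recip-lipschitz {δ} {p} {q} 0<δ δ≤p δ≤q = begin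
    ∣ recip p - recip q ∣
      ≡⟨ cong ∣_∣ (cong₂ _-_
           (trans (sym (ℚ.*-identityʳ (recip p))) (cong (recip p *_) (sym (recip-inverse 0<q))))
           (trans (sym (ℚ.*-identityʳ (recip q))) (cong (recip q *_) (sym (recip-inverse 0<p))))) ⟩
    ∣ recip p * (q * recip q) - recip q * (p * recip p) ∣
      ≡⟨ cong ∣_∣ (solve 4 (λ p q a b → a :* (q :* b) :- b :* (p :* a) := (a :* b) :* (q :- p)) refl p q (recip p) (recip q)) ⟩
    ∣ recip p * recip q * (q - p) ∣
      ≡⟨ ℚ.∣p*q∣≡∣p∣*∣q∣ (recip p * recip q) (q - p) ⟩
    ∣ recip p * recip q ∣ * ∣ q - p ∣
      ≡⟨ cong₂ _*_ (ℚ.0≤p⇒∣p∣≡p (0≤* 0≤rp 0≤rq)) (∣-∣-swap q p) ⟩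
    recip p * recip q * ∣ p - q ∣
      ≤⟨ *-monoʳ _ (ℚ.0≤∣p∣ _) (*-mono 0≤rq 0≤rδ (recip-antimono 0<δ δ≤p) (recip-antimono 0<δ δ≤q)) ⟩
    recip δ * recip δ * ∣ p - q ∣ ∎
    where
    0<p  = ℚ.<-≤-trans 0<δ δ≤p
    0<q  = ℚ.<-≤-trans 0<δ δ≤q
    0≤rp = ℚ.<⇒≤ (0<recip 0<p)
    0≤rq = ℚ.<⇒≤ (0<recip 0<q)
    0≤rδ = ℚ.<⇒≤ (0<recip 0<δ)

  fromℕℚ-suc : ∀ n → fromℕℚ (suc n) ≡ 1ℚ + fromℕℚ n
  fromℕℚ-suc n = ℚ.toℚᵘ-injective (ℚᵘ.≃-trans (ℚ.toℚᵘ-fromℚᵘ (ℚᵘ.mkℚᵘ (ℤ.+ suc n) 0))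
    (ℚᵘ.≃-trans (ℚᵘ.*≡* eq)
    (ℚᵘ.≃-sym (ℚᵘ.≃-trans (ℚ.toℚᵘ-homo-+ 1ℚ (fromℕℚ n))
      (ℚᵘ.+-congʳ (ℚ.toℚᵘ 1ℚ) (ℚ.toℚᵘ-fromℚᵘ (ℚᵘ.mkℚᵘ (ℤ.+ n) 0)))))))
    where
    eq : ℤ.+ suc n ℤ.* ℤ.+ 1 ≡ (ℤ.+ 1 ℤ.+ ℤ.+ n ℤ.* ℤ.+ 1) ℤ.* ℤ.+ 1
    eq = cong (ℤ._* ℤ.+ 1) (cong (λ z → ℤ.+ 1 ℤ.+ z) (sym (ℤ.*-identityʳ (ℤ.+ n))))

  0≤fromℕℚ : ∀ n → 0ℚ ≤ fromℕℚ n
  0≤fromℕℚ n = ℚ.nonNegative⁻¹ _ {{ℚ.normalize-nonNeg n 1}}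

  0<fromℕℚ-suc : ∀ n → 0ℚ < fromℕℚ (suc n)
  0<fromℕℚ-suc n = ℚ.positive⁻¹ _ {{ℚ.normalize-pos (suc n) 1}}

  1≤fromℕℚ-suc : ∀ n → 1ℚ ≤ fromℕℚ (suc n)
  1≤fromℕℚ-suc n = begin
    1ℚ              ≡⟨ ℚ.+-identityʳ 1ℚ ⟨
    1ℚ + 0ℚ         ≤⟨ ℚ.+-monoʳ-≤ 1ℚ (0≤fromℕℚ n) ⟩
    1ℚ + fromℕℚ n   ≡⟨ fromℕℚ-suc n ⟨
    fromℕℚ (suc n)  ∎

  archimedean : ∀ p → ∃[ N ] p ≤ fromℕℚ N
  archimedean p@(ℚ.mkℚ (ℤ.+ n) d _) = n , ℚ.toℚᵘ-cancel-≤
    (ℚᵘ.≤-respʳ-≃ (ℚᵘ.≃-sym (ℚ.toℚᵘ-fromℚᵘ (ℚᵘ.mkℚᵘ (ℤ.+ n) 0)))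
      (ℚᵘ.*≤* (ℤ.*-monoˡ-≤-nonNeg (ℤ.+ n) (ℤ.+≤+ (ℕ.s≤s ℕ.z≤n)))))
  archimedean p@(ℚ.mkℚ ℤ.-[1+ _ ] _ _) = 0 , ℚ.<⇒≤ (ℚ.negative⁻¹ p)

  0≤^ : ∀ {r} n → 0ℚ ≤ r → 0ℚ ≤ r ^ℚ n
  0≤^ zero    0≤r = 0≤1
  0≤^ (suc n) 0≤r = 0≤* 0≤r (0≤^ n 0≤r)

  ^-step : ∀ {r} n → 0ℚ ≤ r → r ≤ 1ℚ → r ^ℚ suc n ≤ r ^ℚ n
  ^-step {r} n 0≤r r≤1 = subst (r ^ℚ suc n ≤_) (ℚ.*-identityˡ _) (*-monoʳ _ (0≤^ n 0≤r) r≤1)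

  ^-antimono : ∀ {r m n} → 0ℚ ≤ r → r ≤ 1ℚ → m ℕ.≤ n → r ^ℚ n ≤ r ^ℚ m
  ^-antimono {r} {m} 0≤r r≤1 m≤n = go (ℕ.≤⇒≤′ m≤n)
    where
    go : ∀ {n} → m ℕ.≤′ n → r ^ℚ n ≤ r ^ℚ m
    go ℕ.≤′-refl     = ℚ.≤-refl
    go (ℕ.≤′-step {n} p) = ℚ.≤-trans (^-step n 0≤r r≤1) (go p)

  ∣^∣≤ : ∀ {y r} n → ∣ y ∣ ≤ r → ∣ y ^ℚ n ∣ ≤ r ^ℚ n
  ∣^∣≤ zero    ∣y∣≤r = ℚ.≤-refl
  ∣^∣≤ {y} {r} (suc n) ∣y∣≤r = begin
    ∣ y * y ^ℚ n ∣      ≡⟨ ℚ.∣p*q∣≡∣p∣*∣q∣ y (y ^ℚ n) ⟩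
    ∣ y ∣ * ∣ y ^ℚ n ∣  ≤⟨ *-mono (ℚ.0≤∣p∣ _) (ℚ.≤-trans (ℚ.0≤∣p∣ y) ∣y∣≤r) ∣y∣≤r (∣^∣≤ n ∣y∣≤r) ⟩
    r * r ^ℚ n          ∎

  ∣^-^∣≤ : ∀ {a b r} n → 0ℚ ≤ r → ∣ a ∣ ≤ r → ∣ b ∣ ≤ r →
           ∣ a ^ℚ suc n - b ^ℚ suc n ∣ ≤ fromℕℚ (suc n) * r ^ℚ n * ∣ a - b ∣
  ∣^-^∣≤ {a} {b} {r} zero 0≤r _ _ = ℚ.≤-reflexive
    (trans (cong ∣_∣ (cong₂ _-_ (ℚ.*-identityʳ a) (ℚ.*-identityʳ b)))
      (sym (trans (cong (_* ∣ a - b ∣) (ℚ.*-identityʳ 1ℚ)) (ℚ.*-identityˡ _))))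
  ∣^-^∣≤ {a} {b} {r} (suc n) 0≤r a≤r b≤r = begin
    ∣ a * A - b * B ∣
      ≡⟨ cong ∣_∣ (solve 4 (λ a b A B → a :* A :- b :* B := a :* (A :- B) :+ B :* (a :- b)) refl a b A B) ⟩
    ∣ a * (A - B) + B * (a - b) ∣
      ≤⟨ ℚ.∣p+q∣≤∣p∣+∣q∣ (a * (A - B)) (B * (a - b)) ⟩
    ∣ a * (A - B) ∣ + ∣ B * (a - b) ∣
      ≡⟨ cong₂ _+_ (ℚ.∣p*q∣≡∣p∣*∣q∣ a (A - B)) (ℚ.∣p*q∣≡∣p∣*∣q∣ B (a - b)) ⟩
    ∣ a ∣ * ∣ A - B ∣ + ∣ B ∣ * d
      ≤⟨ ℚ.+-mono-≤ (*-mono (ℚ.0≤∣p∣ _) 0≤r a≤r (∣^-^∣≤ n 0≤r a≤r b≤r)) (*-monoʳ d (ℚ.0≤∣p∣ _) (∣^∣≤ (suc n) b≤r)) ⟩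
    r * (fromℕℚ (suc n) * r ^ℚ n * d) + r * r ^ℚ n * d
      ≡⟨ solve 4 (λ r c R d → r :* (c :* R :* d) :+ r :* R :* d := (con 1ℚ :+ c) :* (r :* R) :* d) refl r (fromℕℚ (suc n)) (r ^ℚ n) d ⟩
    (1ℚ + fromℕℚ (suc n)) * (r * r ^ℚ n) * d
      ≡⟨ cong (λ c → c * (r * r ^ℚ n) * d) (fromℕℚ-suc (suc n)) ⟨
    fromℕℚ (suc (suc n)) * (r * r ^ℚ n) * d ∎
    where
    A = a ^ℚ suc n
    B = b ^ℚ suc n
    d = ∣ a - b ∣

  geometric : ℚ → ℕ → ℚ
  geometric r zero    = 0ℚ
  geometric r (suc n) = geometric r n + r ^ℚ n

  geometric-sum : ∀ r n → geometric r n * (1ℚ - r) ≡ 1ℚ - r ^ℚ n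
  geometric-sum r zero    = trans (ℚ.*-zeroˡ (1ℚ - r)) refl
  geometric-sum r (suc n) = trans (ℚ.*-distribʳ-+ (1ℚ - r) (geometric r n) (r ^ℚ n))
    (trans (cong (_+ r ^ℚ n * (1ℚ - r)) (geometric-sum r n))
      (solve 2 (λ r R → (con 1ℚ :- R) :+ R :* (con 1ℚ :- r) := con 1ℚ :- r :* R) refl r (r ^ℚ n)))

  n*r^n≤geometric : ∀ {r} n → 0ℚ ≤ r → r ≤ 1ℚ → fromℕℚ n * r ^ℚ n ≤ geometric r n
  n*r^n≤geometric zero    0≤r r≤1 = ℚ.≤-refl
  n*r^n≤geometric {r} (suc n) 0≤r r≤1 = begin
    fromℕℚ (suc n) * r ^ℚ suc n     ≤⟨ *-monoˡ _ (0≤fromℕℚ (suc n)) (^-step n 0≤r r≤1) ⟩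
    fromℕℚ (suc n) * r ^ℚ n         ≡⟨ cong (_* r ^ℚ n) (fromℕℚ-suc n) ⟩
    (1ℚ + fromℕℚ n) * r ^ℚ n        ≡⟨ solve 2 (λ c R → (con 1ℚ :+ c) :* R := c :* R :+ R) refl (fromℕℚ n) (r ^ℚ n) ⟩
    fromℕℚ n * r ^ℚ n + r ^ℚ n      ≤⟨ ℚ.+-monoˡ-≤ (r ^ℚ n) (n*r^n≤geometric n 0≤r r≤1) ⟩
    geometric r n + r ^ℚ n          ∎

  -- Here η is 1 - r.
  geometric≤ : ∀ {r η} n → 0ℚ ≤ r → 0ℚ < η → r + η ≡ 1ℚ → geometric r n ≤ recip η
  geometric≤ {r} {η} n 0≤r 0<η eq = begin
    geometric r n                   ≡⟨ ℚ.*-identityʳ _ ⟨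
    geometric r n * 1ℚ              ≡⟨ cong (geometric r n *_) (recip-inverse 0<η) ⟨
    geometric r n * (η * recip η)   ≡⟨ ℚ.*-assoc (geometric r n) η (recip η) ⟨
    geometric r n * η * recip η     ≡⟨ cong (_* recip η) (trans (cong (geometric r n *_) η≡) (geometric-sum r n)) ⟩
    (1ℚ - r ^ℚ n) * recip η         ≤⟨ *-monoʳ _ (ℚ.<⇒≤ (0<recip 0<η)) ≤1 ⟩
    1ℚ * recip η                    ≡⟨ ℚ.*-identityˡ _ ⟩
    recip η                         ∎
    where
    η≡ : η ≡ 1ℚ - r
    η≡ = trans (solve 2 (λ r η → η := (r :+ η) :- r) refl r η) (cong (_- r) eq)
    ≤1 : 1ℚ - r ^ℚ n ≤ 1ℚ
    ≤1 = subst (1ℚ - r ^ℚ n ≤_) (ℚ.+-identityʳ 1ℚ) (ℚ.+-monoʳ-≤ 1ℚ (ℚ.neg-antimono-≤ (0≤^ n 0≤r)))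

  ^-tendsto-0 : ∀ {r η} → 0ℚ ≤ r → 0ℚ < η → r + η ≡ 1ℚ → ∀ ε → 0ℚ < ε → ∃[ N ] r ^ℚ N ≤ ε
  ^-tendsto-0 {r} {η} 0≤r 0<η eq ε 0<ε = N , (begin
    r ^ℚ N                                  ≡⟨ ℚ.*-identityˡ _ ⟨
    1ℚ * r ^ℚ N                             ≡⟨ cong (_* r ^ℚ N) (recip-inverse 0<N) ⟨
    fromℕℚ N * recip (fromℕℚ N) * r ^ℚ N    ≡⟨ solve 3 (λ a b c → a :* b :* c := b :* (a :* c)) refl (fromℕℚ N) (recip (fromℕℚ N)) (r ^ℚ N) ⟩
    recip (fromℕℚ N) * (fromℕℚ N * r ^ℚ N)  ≤⟨ *-monoˡ _ (ℚ.<⇒≤ (0<recip 0<N)) (ℚ.≤-trans (n*r^n≤geometric N 0≤r r≤1) (geometric≤ N 0≤r 0<η eq)) ⟩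
    recip (fromℕℚ N) * recip η              ≡⟨ cong (recip (fromℕℚ N) *_) (trans (cong (recip η *_) (recip-inverse 0<ε)) (ℚ.*-identityʳ _)) ⟨
    recip (fromℕℚ N) * (recip η * (ε * recip ε)) ≡⟨ solve 4 (λ a b c d → a :* (b :* (c :* d)) := a :* (b :* d) :* c) refl (recip (fromℕℚ N)) (recip η) ε (recip ε) ⟩
    recip (fromℕℚ N) * (recip η * recip ε) * ε   ≤⟨ *-monoʳ ε (ℚ.<⇒≤ 0<ε) (*-monoˡ _ (ℚ.<⇒≤ (0<recip 0<N)) bound) ⟩
    recip (fromℕℚ N) * fromℕℚ N * ε         ≡⟨ cong (_* ε) (trans (ℚ.*-comm (recip (fromℕℚ N)) (fromℕℚ N)) (recip-inverse 0<N)) ⟩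
    1ℚ * ε                                  ≡⟨ ℚ.*-identityˡ ε ⟩
    ε                                       ∎)
    where
    arch = archimedean (recip η * recip ε)
    N = suc (proj₁ arch)
    0<N = 0<fromℕℚ-suc (proj₁ arch)
    r≤1 : r ≤ 1ℚ
    r≤1 = subst₂ _≤_ (ℚ.+-identityʳ r) eq (ℚ.+-monoʳ-≤ r (ℚ.<⇒≤ 0<η))
    bound : recip η * recip ε ≤ fromℕℚ N
    bound = begin
      recip η * recip ε            ≤⟨ proj₂ arch ⟩
      fromℕℚ (proj₁ arch)          ≡⟨ ℚ.+-identityˡ _ ⟨
      0ℚ + fromℕℚ (proj₁ arch)     ≤⟨ ℚ.+-monoˡ-≤ (fromℕℚ (proj₁ arch)) 0≤1 ⟩
      1ℚ + fromℕℚ (proj₁ arch)     ≡⟨ fromℕℚ-suc (proj₁ arch) ⟨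
      fromℕℚ N                     ∎

-- Real numbers are Cauchy sequences of rationals.
Cauchy : (ℕ → ℚ) → Set
Cauchy s = ∀ ε → 0ℚ ℚ.< ε → ∃[ N ] ∀ m n → N ℕ.≤ m → N ℕ.≤ n → ℚ.∣ s m ℚ.- s n ∣ ℚ.≤ ε

-- There is no quotient: all relations between reals are expressed through _<_ and _≤_ below.
record ℝ : Set where
  constructor mkℝ
  field
    seq    : ℕ → ℚ
    cauchy : Cauchy seq

open ℝ public

infix 4 _<_ _≤_

_<_ : ℝ → ℝ → Set
x < y = ∃[ δ ] 0ℚ ℚ.< δ × ∃[ N ] ∀ n → N ℕ.≤ n → seq x n ℚ.+ δ ℚ.≤ seq y n

_≤_ : ℝ → ℝ → Set
x ≤ y = ∀ ε → 0ℚ ℚ.< ε → ∃[ N ] ∀ n → N ℕ.≤ n → seq x n ℚ.≤ seq y n ℚ.+ ε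

module Cauchy-Lemmas where
  open import Data.Rational.Base using (_+_; _*_; _-_; -_; ∣_∣) renaming (_≤_ to _≤ℚ_; _<_ to _<ℚ_)
  open ℚ.≤-Reasoning
  open +-*-Solver using (solve; _:=_; _:+_; _:*_; _:-_; :-_; con)
  open ℚ-Lemmas

  constant : ∀ q → Cauchy (λ _ → q)
  constant q ε 0<ε = 0 , λ _ _ _ _ → subst (_≤ℚ ε) (sym (cong ∣_∣ (ℚ.+-inverseʳ q))) (ℚ.<⇒≤ 0<ε)

  bounded : ∀ {s} → Cauchy s → ∃[ B ] 0ℚ <ℚ B × ∃[ N ] ∀ n → N ℕ.≤ n → ∣ s n ∣ ≤ℚ B
  bounded {s} s-cauchy with s-cauchy 1ℚ 0<1
  ... | N , close = 1ℚ + ∣ s N ∣ , 0<+ 0<1 (ℚ.0≤∣p∣ (s N)) , N , λ n N≤n → begin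
    ∣ s n ∣                    ≡⟨ cong ∣_∣ (solve 2 (λ a b → a := (a :- b) :+ b) refl (s n) (s N)) ⟩
    ∣ (s n - s N) + s N ∣      ≤⟨ ℚ.∣p+q∣≤∣p∣+∣q∣ (s n - s N) (s N) ⟩
    ∣ s n - s N ∣ + ∣ s N ∣    ≤⟨ ℚ.+-monoˡ-≤ ∣ s N ∣ (close n N N≤n ℕ.≤-refl) ⟩
    1ℚ + ∣ s N ∣               ∎

  lipschitz : ∀ (s t u : ℕ → ℚ) K N → 0ℚ <ℚ K → Cauchy s → Cauchy t →
              (∀ m n → N ℕ.≤ m → N ℕ.≤ n → ∣ u m - u n ∣ ≤ℚ K * (∣ s m - s n ∣ + ∣ t m - t n ∣)) →
              Cauchy u
  lipschitz s t u K N 0<K s-cauchy t-cauchy close ε 0<ε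
    with s-cauchy (ℚ.½ * ε * recip K) (0<* (0<* 0<½ 0<ε) (0<recip 0<K))
       | t-cauchy (ℚ.½ * ε * recip K) (0<* (0<* 0<½ 0<ε) (0<recip 0<K))
  ... | M , s-close | L , t-close = N ℕ.⊔ (M ℕ.⊔ L) , λ m n p q → begin
    ∣ u m - u n ∣                                      ≤⟨ close m n (lN p) (lN q) ⟩
    K * (∣ s m - s n ∣ + ∣ t m - t n ∣)                ≤⟨ *-monoˡ K (ℚ.<⇒≤ 0<K) (ℚ.+-mono-≤ (s-close m n (lM p) (lM q)) (t-close m n (lL p) (lL q))) ⟩
    K * (ℚ.½ * ε * recip K + ℚ.½ * ε * recip K)        ≡⟨ solve 3 (λ K ε k → K :* (con ℚ.½ :* ε :* k :+ con ℚ.½ :* ε :* k) := K :* k :* ε) refl K ε (recip K) ⟩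
    K * recip K * ε                                    ≡⟨ cong (_* ε) (recip-inverse 0<K) ⟩
    1ℚ * ε                                             ≡⟨ ℚ.*-identityˡ ε ⟩
    ε                                                  ∎
    where
    lN : ∀ {m} → N ℕ.⊔ (M ℕ.⊔ L) ℕ.≤ m → N ℕ.≤ m
    lN = ℕ.m⊔n≤o⇒m≤o N (M ℕ.⊔ L)
    lM : ∀ {m} → N ℕ.⊔ (M ℕ.⊔ L) ℕ.≤ m → M ℕ.≤ m
    lM p = ℕ.m⊔n≤o⇒m≤o M L (ℕ.m⊔n≤o⇒n≤o N (M ℕ.⊔ L) p)
    lL : ∀ {m} → N ℕ.⊔ (M ℕ.⊔ L) ℕ.≤ m → L ℕ.≤ m
    lL p = ℕ.m⊔n≤o⇒n≤o M L (ℕ.m⊔n≤o⇒n≤o N (M ℕ.⊔ L) p)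

  lipschitz₁ : ∀ (s u : ℕ → ℚ) K N → 0ℚ <ℚ K → Cauchy s →
               (∀ m n → N ℕ.≤ m → N ℕ.≤ n → ∣ u m - u n ∣ ≤ℚ K * ∣ s m - s n ∣) → Cauchy u
  lipschitz₁ s u K N 0<K s-cauchy close =
    lipschitz s (λ _ → 0ℚ) u K N 0<K s-cauchy (constant 0ℚ) λ m n p q →
      subst (∣ u m - u n ∣ ≤ℚ_) (cong (K *_) (sym (ℚ.+-identityʳ ∣ s m - s n ∣))) (close m n p q)

  add : ∀ {s t} → Cauchy s → Cauchy t → Cauchy (λ n → s n + t n)
  add {s} {t} sc tc = lipschitz s t (λ n → s n + t n) 1ℚ 0 0<1 sc tc λ m n _ _ → begin
    ∣ (s m + t m) - (s n + t n) ∣           ≡⟨ cong ∣_∣ (solve 4 (λ a b c d → (a :+ b) :- (c :+ d) := (a :- c) :+ (b :- d)) refl (s m) (t m) (s n) (t n)) ⟩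
    ∣ (s m - s n) + (t m - t n) ∣           ≤⟨ ℚ.∣p+q∣≤∣p∣+∣q∣ (s m - s n) (t m - t n) ⟩
    ∣ s m - s n ∣ + ∣ t m - t n ∣           ≡⟨ ℚ.*-identityˡ _ ⟨
    1ℚ * (∣ s m - s n ∣ + ∣ t m - t n ∣)    ∎

  neg : ∀ {s} → Cauchy s → Cauchy (λ n → - s n)
  neg {s} sc = lipschitz₁ s (λ n → - s n) 1ℚ 0 0<1 sc λ m n _ _ → ℚ.≤-reflexive (begin-equality
    ∣ - s m - - s n ∣      ≡⟨ cong ∣_∣ (solve 2 (λ a b → :- a :- :- b := b :- a) refl (s m) (s n)) ⟩
    ∣ s n - s m ∣          ≡⟨ ∣-∣-swap (s n) (s m) ⟩
    ∣ s m - s n ∣          ≡⟨ ℚ.*-identityˡ _ ⟨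
    1ℚ * ∣ s m - s n ∣     ∎)

  abs : ∀ {s} → Cauchy s → Cauchy (λ n → ∣ s n ∣)
  abs {s} sc = lipschitz₁ s (λ n → ∣ s n ∣) 1ℚ 0 0<1 sc λ m n _ _ →
    subst (∣ ∣ s m ∣ - ∣ s n ∣ ∣ ≤ℚ_) (sym (ℚ.*-identityˡ _)) (∣∣p∣-∣q∣∣≤∣p-q∣ (s m) (s n))

  mul : ∀ {s t} → Cauchy s → Cauchy t → Cauchy (λ n → s n * t n)
  mul {s} {t} sc tc = go (bounded {s} sc) (bounded {t} tc)
    where
    go : (∃[ B ] 0ℚ <ℚ B × ∃[ N ] ∀ n → N ℕ.≤ n → ∣ s n ∣ ≤ℚ B) →
         (∃[ C ] 0ℚ <ℚ C × ∃[ N ] ∀ n → N ℕ.≤ n → ∣ t n ∣ ≤ℚ C) → Cauchy (λ n → s n * t n)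
    go (B , 0<B , M , ∣s∣≤B) (C , 0<C , L , ∣t∣≤C) =
      lipschitz s t (λ n → s n * t n) (B + C) (M ℕ.⊔ L) (0<+ 0<B (ℚ.<⇒≤ 0<C)) sc tc λ m n p q →
        *-lipschitz (s m) (t m) (s n) (t n) (ℚ.<⇒≤ 0<B) (ℚ.<⇒≤ 0<C)
          (∣s∣≤B m (ℕ.m⊔n≤o⇒m≤o M L p)) (∣t∣≤C n (ℕ.m⊔n≤o⇒n≤o M L q))

  inverse : ∀ {s δ N} → Cauchy s → 0ℚ <ℚ δ → (∀ n → N ℕ.≤ n → δ ≤ℚ s n) → Cauchy (λ n → recip (s n))
  inverse {s} {δ} {N} sc 0<δ δ≤s =
    lipschitz₁ s (λ n → recip (s n)) (recip δ * recip δ) N (0<* (0<recip 0<δ) (0<recip 0<δ)) sc λ m n p q →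
      recip-lipschitz 0<δ (δ≤s m p) (δ≤s n q)

  powers : ∀ {r η} → 0ℚ ≤ℚ r → 0ℚ <ℚ η → r + η ≡ 1ℚ → Cauchy (r ^ℚ_)
  powers {r} {η} 0≤r 0<η eq ε 0<ε = N , λ m n p q → ∣p∣≤ (below m n p)
      (subst (_≤ℚ ε) (solve 2 (λ a b → b :- a := :- (a :- b)) refl (r ^ℚ m) (r ^ℚ n)) (below n m q))
    where
    small = ^-tendsto-0 0≤r 0<η eq ε 0<ε
    N = proj₁ small
    r≤1 : r ≤ℚ 1ℚ
    r≤1 = subst₂ _≤ℚ_ (ℚ.+-identityʳ r) eq (ℚ.+-monoʳ-≤ r (ℚ.<⇒≤ 0<η))
    below : ∀ m n → N ℕ.≤ m → r ^ℚ m - r ^ℚ n ≤ℚ ε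
    below m n N≤m = begin
      r ^ℚ m - r ^ℚ n  ≤⟨ ℚ.+-monoʳ-≤ (r ^ℚ m) (ℚ.neg-antimono-≤ (0≤^ n 0≤r)) ⟩
      r ^ℚ m + 0ℚ      ≡⟨ ℚ.+-identityʳ _ ⟩
      r ^ℚ m           ≤⟨ ^-antimono 0≤r r≤1 N≤m ⟩
      r ^ℚ N           ≤⟨ proj₂ small ⟩
      ε                ∎

fromℚ : ℚ → ℝ
fromℚ q = mkℝ (λ _ → q) (Cauchy-Lemmas.constant q)

fromℕ : ℕ → ℝ
fromℕ n = fromℚ (fromℕℚ n)

0ℝ 1ℝ : ℝ
0ℝ = fromℕ 0
1ℝ = fromℕ 1

infixl 6 _+_ _-_
infixl 7 _*_ _/_[_]
infix  9 _⁻¹[_]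
infixr 8 _^_

_+_ : ℝ → ℝ → ℝ
x + y = mkℝ (λ n → seq x n ℚ.+ seq y n) (Cauchy-Lemmas.add {seq x} {seq y} (cauchy x) (cauchy y))

-_ : ℝ → ℝ
- x = mkℝ (λ n → ℚ.- seq x n) (Cauchy-Lemmas.neg {seq x} (cauchy x))

_-_ : ℝ → ℝ → ℝ
x - y = x + - y

_*_ : ℝ → ℝ → ℝ
x * y = mkℝ (λ n → seq x n ℚ.* seq y n) (Cauchy-Lemmas.mul {seq x} {seq y} (cauchy x) (cauchy y))

∣_∣ : ℝ → ℝ
∣ x ∣ = mkℝ (λ n → ℚ.∣ seq x n ∣) (Cauchy-Lemmas.abs {seq x} (cauchy x))

_^_ : ℝ → ℕ → ℝ
x ^ zero  = 1ℝ
x ^ suc k = x * x ^ k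

bounded-below : ∀ {x} → 0ℝ < x → ∃[ δ ] 0ℚ ℚ.< δ × ∃[ N ] ∀ n → N ℕ.≤ n → δ ℚ.≤ seq x n
bounded-below {x} (δ , 0<δ , N , p) = δ , 0<δ , N , λ n N≤n → subst (ℚ._≤ seq x n) (ℚ.+-identityˡ δ) (p n N≤n)

_⁻¹[_] : (x : ℝ) → 0ℝ < x → ℝ
x ⁻¹[ 0<x ] = mkℝ (λ n → recip (seq x n)) (Cauchy-Lemmas.inverse {seq x} (cauchy x) 0<δ δ≤x)
  where
  0<δ = proj₁ (proj₂ (bounded-below {x} 0<x))
  δ≤x = proj₂ (proj₂ (proj₂ (bounded-below {x} 0<x)))

_/_[_] : ℝ → (y : ℝ) → 0ℝ < y → ℝ
x / y [ 0<y ] = x * y ⁻¹[ 0<y ]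

-- The n-th partial sum of artanh y = y + y³/3 + y⁵/5 + ⋯ for ∣y∣ < 1.
artanhTerm : ℚ → ℕ → ℚ
artanhTerm y i = y ^ℚ suc (2 ℕ.* i) ℚ.* recip (fromℕℚ (suc (2 ℕ.* i)))

artanhSum : ℚ → ℕ → ℚ
artanhSum y zero    = 0ℚ
artanhSum y (suc n) = artanhSum y n ℚ.+ artanhTerm y n

module Artanh-Lemmas where
  open import Data.Rational.Base using () renaming
    (_+_ to _+ℚ_; _*_ to _*ℚ_; _-_ to _-ℚ_; -_ to -ℚ_; ∣_∣ to ∣_∣ℚ; _≤_ to _≤ℚ_; _<_ to _<ℚ_)
  open ℚ.≤-Reasoning
  open +-*-Solver using (solve; _:=_; _:+_; _:*_; _:-_; :-_; con)
  open ℚ-Lemmas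

  weight : ℕ → ℚ
  weight i = recip (fromℕℚ (suc (2 ℕ.* i)))

  0≤weight : ∀ i → 0ℚ ≤ℚ weight i
  0≤weight i = ℚ.<⇒≤ (0<recip (0<fromℕℚ-suc (2 ℕ.* i)))

  weight≤1 : ∀ i → weight i ≤ℚ 1ℚ
  weight≤1 i = recip-antimono 0<1 (1≤fromℕℚ-suc (2 ℕ.* i))

  module _ {r η : ℚ} (0≤r : 0ℚ ≤ℚ r) (0<η : 0ℚ <ℚ η) (r+η≡1 : r +ℚ η ≡ 1ℚ) where

    r≤1 : r ≤ℚ 1ℚ
    r≤1 = subst₂ _≤ℚ_ (ℚ.+-identityʳ r) r+η≡1 (ℚ.+-monoʳ-≤ r (ℚ.<⇒≤ 0<η))

    i≤2i : ∀ i → i ℕ.≤ 2 ℕ.* i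
    i≤2i i = ℕ.m≤m+n i (i ℕ.+ 0)

    term-bound : ∀ b i → ∣ b ∣ℚ ≤ℚ r → ∣ artanhTerm b i ∣ℚ ≤ℚ r ^ℚ i
    term-bound b i b≤r = begin
      ∣ b ^ℚ suc (2 ℕ.* i) *ℚ weight i ∣ℚ         ≡⟨ ℚ.∣p*q∣≡∣p∣*∣q∣ (b ^ℚ suc (2 ℕ.* i)) (weight i) ⟩
      ∣ b ^ℚ suc (2 ℕ.* i) ∣ℚ *ℚ ∣ weight i ∣ℚ    ≡⟨ cong (∣ b ^ℚ suc (2 ℕ.* i) ∣ℚ *ℚ_) (ℚ.0≤p⇒∣p∣≡p (0≤weight i)) ⟩
      ∣ b ^ℚ suc (2 ℕ.* i) ∣ℚ *ℚ weight i         ≤⟨ *-mono (0≤weight i) (0≤^ i 0≤r) powBound (weight≤1 i) ⟩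
      r ^ℚ i *ℚ 1ℚ                                ≡⟨ ℚ.*-identityʳ (r ^ℚ i) ⟩
      r ^ℚ i                                      ∎
      where
      powBound : ∣ b ^ℚ suc (2 ℕ.* i) ∣ℚ ≤ℚ r ^ℚ i
      powBound = ℚ.≤-trans (∣^∣≤ (suc (2 ℕ.* i)) b≤r)
                           (^-antimono 0≤r r≤1 (ℕ.m≤n⇒m≤1+n (i≤2i i)))

    term-lipschitz : ∀ a b i → ∣ a ∣ℚ ≤ℚ r → ∣ b ∣ℚ ≤ℚ r →
                     ∣ artanhTerm a i -ℚ artanhTerm b i ∣ℚ ≤ℚ r ^ℚ i *ℚ ∣ a -ℚ b ∣ℚ
    term-lipschitz a b i a≤r b≤r = begin
      ∣ A *ℚ w -ℚ B *ℚ w ∣ℚ                  ≡⟨ cong ∣_∣ℚ (solve 3 (λ A B w → A :* w :- B :* w := (A :- B) :* w) refl A B w) ⟩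
      ∣ (A -ℚ B) *ℚ w ∣ℚ                     ≡⟨ ℚ.∣p*q∣≡∣p∣*∣q∣ (A -ℚ B) w ⟩
      ∣ A -ℚ B ∣ℚ *ℚ ∣ w ∣ℚ                  ≡⟨ cong (∣ A -ℚ B ∣ℚ *ℚ_) (ℚ.0≤p⇒∣p∣≡p (0≤weight i)) ⟩
      ∣ A -ℚ B ∣ℚ *ℚ w                       ≤⟨ *-monoʳ w (0≤weight i) (∣^-^∣≤ (2 ℕ.* i) 0≤r a≤r b≤r) ⟩
      c *ℚ R *ℚ d *ℚ w                       ≡⟨ solve 4 (λ c R d w → c :* R :* d :* w := c :* w :* (R :* d)) refl c R d w ⟩
      c *ℚ w *ℚ (R *ℚ d)                     ≡⟨ cong (_*ℚ (R *ℚ d)) (recip-inverse (0<fromℕℚ-suc (2 ℕ.* i))) ⟩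
      1ℚ *ℚ (R *ℚ d)                         ≡⟨ ℚ.*-identityˡ (R *ℚ d) ⟩
      R *ℚ d                                 ≤⟨ *-monoʳ d (ℚ.0≤∣p∣ (a -ℚ b)) (^-antimono 0≤r r≤1 (i≤2i i)) ⟩
      r ^ℚ i *ℚ d                            ∎
      where
      A = a ^ℚ suc (2 ℕ.* i)
      B = b ^ℚ suc (2 ℕ.* i)
      w = weight i
      c = fromℕℚ (suc (2 ℕ.* i))
      R = r ^ℚ (2 ℕ.* i)
      d = ∣ a -ℚ b ∣ℚ

    sum-lipschitz : ∀ a b n → ∣ a ∣ℚ ≤ℚ r → ∣ b ∣ℚ ≤ℚ r →
                    ∣ artanhSum a n -ℚ artanhSum b n ∣ℚ ≤ℚ geometric r n *ℚ ∣ a -ℚ b ∣ℚ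
    sum-lipschitz a b zero    _ _ = ℚ.≤-reflexive (sym (ℚ.*-zeroˡ ∣ a -ℚ b ∣ℚ))
    sum-lipschitz a b (suc n) a≤r b≤r = begin
      ∣ (S +ℚ s) -ℚ (T +ℚ t) ∣ℚ                      ≡⟨ cong ∣_∣ℚ (solve 4 (λ S s T t → (S :+ s) :- (T :+ t) := (S :- T) :+ (s :- t)) refl S s T t) ⟩
      ∣ (S -ℚ T) +ℚ (s -ℚ t) ∣ℚ                      ≤⟨ ℚ.∣p+q∣≤∣p∣+∣q∣ (S -ℚ T) (s -ℚ t) ⟩
      ∣ S -ℚ T ∣ℚ +ℚ ∣ s -ℚ t ∣ℚ                     ≤⟨ ℚ.+-mono-≤ (sum-lipschitz a b n a≤r b≤r) (term-lipschitz a b n a≤r b≤r) ⟩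
      geometric r n *ℚ d +ℚ r ^ℚ n *ℚ d              ≡⟨ ℚ.*-distribʳ-+ d (geometric r n) (r ^ℚ n) ⟨
      geometric r (suc n) *ℚ d                       ∎
      where
      S = artanhSum a n
      T = artanhSum b n
      s = artanhTerm a n
      t = artanhTerm b n
      d = ∣ a -ℚ b ∣ℚ

    sum-tail : ∀ b {m n} → ∣ b ∣ℚ ≤ℚ r → m ℕ.≤′ n →
               ∣ artanhSum b n -ℚ artanhSum b m ∣ℚ ≤ℚ geometric r n -ℚ geometric r m
    sum-tail b {m} b≤r ℕ.≤′-refl = ℚ.≤-reflexive
      (trans (cong ∣_∣ℚ (ℚ.+-inverseʳ (artanhSum b m))) (sym (ℚ.+-inverseʳ (geometric r m))))
    sum-tail b {m} b≤r (ℕ.≤′-step {n} m≤n) = begin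
      ∣ (S +ℚ s) -ℚ T ∣ℚ                             ≡⟨ cong ∣_∣ℚ (solve 3 (λ S s T → (S :+ s) :- T := (S :- T) :+ s) refl S s T) ⟩
      ∣ (S -ℚ T) +ℚ s ∣ℚ                             ≤⟨ ℚ.∣p+q∣≤∣p∣+∣q∣ (S -ℚ T) s ⟩
      ∣ S -ℚ T ∣ℚ +ℚ ∣ s ∣ℚ                          ≤⟨ ℚ.+-mono-≤ (sum-tail b b≤r m≤n) (term-bound b n b≤r) ⟩
      (G -ℚ H) +ℚ r ^ℚ n                             ≡⟨ solve 3 (λ G H R → (G :- H) :+ R := (G :+ R) :- H) refl G H (r ^ℚ n) ⟩
      (G +ℚ r ^ℚ n) -ℚ H                             ∎
      where
      S = artanhSum b n
      T = artanhSum b m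
      s = artanhTerm b n
      G = geometric r n
      H = geometric r m

    sum-tail′ : ∀ b m n → ∣ b ∣ℚ ≤ℚ r →
                ∣ artanhSum b m -ℚ artanhSum b n ∣ℚ ≤ℚ ∣ geometric r m -ℚ geometric r n ∣ℚ
    sum-tail′ b m n b≤r = go (ℕ.≤-total m n)
      where
      go : m ℕ.≤ n ⊎ n ℕ.≤ m →
           ∣ artanhSum b m -ℚ artanhSum b n ∣ℚ ≤ℚ ∣ geometric r m -ℚ geometric r n ∣ℚ
      go (inj₂ n≤m) = ℚ.≤-trans (sum-tail b b≤r (ℕ.≤⇒≤′ n≤m)) (p≤∣p∣ (geometric r m -ℚ geometric r n))
      go (inj₁ m≤n) = subst₂ _≤ℚ_ (∣-∣-swap (artanhSum b n) (artanhSum b m)) (∣-∣-swap (geometric r n) (geometric r m))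
        (ℚ.≤-trans (sum-tail b b≤r (ℕ.≤⇒≤′ m≤n)) (p≤∣p∣ (geometric r n -ℚ geometric r m)))

    geometric-cauchy : Cauchy (geometric r)
    geometric-cauchy = Cauchy-Lemmas.lipschitz₁ (r ^ℚ_) (geometric r) (recip η) 0 (0<recip 0<η)
      (Cauchy-Lemmas.powers 0≤r 0<η r+η≡1) λ m n _ _ → ℚ.≤-reflexive (begin-equality
        ∣ geometric r m -ℚ geometric r n ∣ℚ
          ≡⟨ cong ∣_∣ℚ (cong₂ _-ℚ_ (closed m) (closed n)) ⟩
        ∣ recip η *ℚ (1ℚ -ℚ r ^ℚ m) -ℚ recip η *ℚ (1ℚ -ℚ r ^ℚ n) ∣ℚ
          ≡⟨ cong ∣_∣ℚ (solve 3 (λ k R S → k :* (con 1ℚ :- R) :- k :* (con 1ℚ :- S) := k :* (S :- R)) refl (recip η) (r ^ℚ m) (r ^ℚ n)) ⟩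
        ∣ recip η *ℚ (r ^ℚ n -ℚ r ^ℚ m) ∣ℚ
          ≡⟨ ℚ.∣p*q∣≡∣p∣*∣q∣ (recip η) (r ^ℚ n -ℚ r ^ℚ m) ⟩
        ∣ recip η ∣ℚ *ℚ ∣ r ^ℚ n -ℚ r ^ℚ m ∣ℚ
          ≡⟨ cong₂ _*ℚ_ (ℚ.0≤p⇒∣p∣≡p (ℚ.<⇒≤ (0<recip 0<η))) (∣-∣-swap (r ^ℚ n) (r ^ℚ m)) ⟩
        recip η *ℚ ∣ r ^ℚ m -ℚ r ^ℚ n ∣ℚ ∎)
      where
      closed : ∀ n → geometric r n ≡ recip η *ℚ (1ℚ -ℚ r ^ℚ n)
      closed n = begin-equality
        geometric r n                          ≡⟨ ℚ.*-identityˡ (geometric r n) ⟨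
        1ℚ *ℚ geometric r n                    ≡⟨ cong (_*ℚ geometric r n) (recip-inverse 0<η) ⟨
        η *ℚ recip η *ℚ geometric r n          ≡⟨ solve 3 (λ a b c → a :* b :* c := b :* (c :* a)) refl η (recip η) (geometric r n) ⟩
        recip η *ℚ (geometric r n *ℚ η)        ≡⟨ cong (λ z → recip η *ℚ (geometric r n *ℚ z)) (trans (solve 2 (λ r η → η := (r :+ η) :- r) refl r η) (cong (_-ℚ r) r+η≡1)) ⟩
        recip η *ℚ (geometric r n *ℚ (1ℚ -ℚ r)) ≡⟨ cong (recip η *ℚ_) (geometric-sum r n) ⟩
        recip η *ℚ (1ℚ -ℚ r ^ℚ n)              ∎

    diagonal-cauchy : ∀ (s : ℕ → ℚ) N → Cauchy s → (∀ n → N ℕ.≤ n → ∣ s n ∣ℚ ≤ℚ r) →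
                      Cauchy (λ n → artanhSum (s n) n)
    diagonal-cauchy s N sc s≤r = Cauchy-Lemmas.lipschitz s (geometric r) (λ n → artanhSum (s n) n)
      (recip η +ℚ 1ℚ) N (0<+ (0<recip 0<η) 0≤1) sc geometric-cauchy λ m n p q → begin
        ∣ artanhSum (s m) m -ℚ artanhSum (s n) n ∣ℚ
          ≤⟨ triangle (artanhSum (s m) m) (artanhSum (s n) m) (artanhSum (s n) n) ⟩
        ∣ artanhSum (s m) m -ℚ artanhSum (s n) m ∣ℚ +ℚ ∣ artanhSum (s n) m -ℚ artanhSum (s n) n ∣ℚ
          ≤⟨ ℚ.+-mono-≤
               (ℚ.≤-trans (sum-lipschitz (s m) (s n) m (s≤r m p) (s≤r n q))
                 (*-mono (ℚ.0≤∣p∣ (s m -ℚ s n)) 0≤K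
                   (ℚ.≤-trans (geometric≤ m 0≤r 0<η r+η≡1) η≤K) (ℚ.≤-refl {∣ s m -ℚ s n ∣ℚ})))
               (ℚ.≤-trans (sum-tail′ (s n) m n (s≤r n q))
                 (subst (_≤ℚ K *ℚ D m n) (ℚ.*-identityˡ (D m n))
                   (*-monoʳ (D m n) (ℚ.0≤∣p∣ (geometric r m -ℚ geometric r n)) 1≤K))) ⟩
        K *ℚ ∣ s m -ℚ s n ∣ℚ +ℚ K *ℚ D m n
          ≡⟨ ℚ.*-distribˡ-+ K ∣ s m -ℚ s n ∣ℚ (D m n) ⟨
        K *ℚ (∣ s m -ℚ s n ∣ℚ +ℚ D m n) ∎
      where
      K = recip η +ℚ 1ℚ
      D : ℕ → ℕ → ℚ
      D m n = ∣ geometric r m -ℚ geometric r n ∣ℚ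
      0≤η′ = ℚ.<⇒≤ (0<recip 0<η)
      η≤K : recip η ≤ℚ K
      η≤K = subst (_≤ℚ K) (ℚ.+-identityʳ (recip η)) (ℚ.+-monoʳ-≤ (recip η) 0≤1)
      1≤K : 1ℚ ≤ℚ K
      1≤K = subst (_≤ℚ K) (ℚ.+-identityˡ 1ℚ) (ℚ.+-monoˡ-≤ 1ℚ 0≤η′)
      0≤K : 0ℚ ≤ℚ K
      0≤K = ℚ.≤-trans 0≤1 1≤K

  artanh-cauchy : ∀ (y : ℝ) → ∣ y ∣ < 1ℝ → Cauchy (λ n → artanhSum (seq y n) n)
  artanh-cauchy y (η , 0<η , N , y+η≤1) =
    diagonal-cauchy {1ℚ -ℚ η} {η} 0≤r 0<η (solve 1 (λ η → (con 1ℚ :- η) :+ η := con 1ℚ) refl η)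
      (seq y) N (cauchy y) y≤r
    where
    y≤r : ∀ n → N ℕ.≤ n → ∣ seq y n ∣ℚ ≤ℚ 1ℚ -ℚ η
    y≤r n N≤n = subst (_≤ℚ 1ℚ -ℚ η) (solve 2 (λ a η → (a :+ η) :- η := a) refl ∣ seq y n ∣ℚ η)
      (ℚ.+-monoˡ-≤ (-ℚ η) (y+η≤1 n N≤n))
    0≤r : 0ℚ ≤ℚ 1ℚ -ℚ η
    0≤r = ℚ.≤-trans (ℚ.0≤∣p∣ (seq y N)) (y≤r N ℕ.≤-refl)

  sum-positive : ∀ {y} n → 0ℚ ≤ℚ y → 1 ℕ.≤ n → y ≤ℚ artanhSum y n
  sum-positive {y} (suc zero)    0≤y _ = ℚ.≤-reflexive (begin-equality
    y                          ≡⟨ ℚ.*-identityʳ y ⟨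
    y *ℚ 1ℚ                    ≡⟨ ℚ.*-identityʳ (y *ℚ 1ℚ) ⟨
    y *ℚ 1ℚ *ℚ 1ℚ              ≡⟨ ℚ.+-identityˡ (y *ℚ 1ℚ *ℚ 1ℚ) ⟨
    0ℚ +ℚ y *ℚ 1ℚ *ℚ 1ℚ        ∎)
  sum-positive {y} (suc n@(suc _)) 0≤y _ = begin
    y                                   ≤⟨ sum-positive n 0≤y (ℕ.s≤s ℕ.z≤n) ⟩
    artanhSum y n                       ≡⟨ ℚ.+-identityʳ (artanhSum y n) ⟨
    artanhSum y n +ℚ 0ℚ                 ≤⟨ ℚ.+-monoʳ-≤ (artanhSum y n) (0≤* (0≤^ (suc (2 ℕ.* n)) 0≤y) (0≤weight n)) ⟩
    artanhSum y n +ℚ artanhTerm y n     ∎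

artanh : (y : ℝ) → ∣ y ∣ < 1ℝ → ℝ
artanh y ∣y∣<1 = mkℝ (λ n → artanhSum (seq y n) n) (Artanh-Lemmas.artanh-cauchy y ∣y∣<1)

module Positivity where
  open import Data.Rational.Base using () renaming
    (_+_ to _+ℚ_; _*_ to _*ℚ_; _-_ to _-ℚ_; -_ to -ℚ_; ∣_∣ to ∣_∣ℚ; _≤_ to _≤ℚ_; _<_ to _<ℚ_)
  open ℚ.≤-Reasoning
  open +-*-Solver using (solve; _:=_; _:+_; _:*_; _:-_; :-_; con)
  open ℚ-Lemmas

  mk-0< : ∀ {x} δ N → 0ℚ <ℚ δ → (∀ n → N ℕ.≤ n → δ ≤ℚ seq x n) → 0ℝ < x
  mk-0< {x} δ N 0<δ δ≤x = δ , 0<δ , N , λ n N≤n → subst (_≤ℚ seq x n) (sym (ℚ.+-identityˡ δ)) (δ≤x n N≤n)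

  0<1ℝ : 0ℝ < 1ℝ
  0<1ℝ = mk-0< {1ℝ} 1ℚ 0 0<1 λ _ _ → ℚ.≤-refl

  *-pos : ∀ {x y} → 0ℝ < x → 0ℝ < y → 0ℝ < x * y
  *-pos {x} {y} 0<x 0<y = go (bounded-below {x} 0<x) (bounded-below {y} 0<y)
    where
    go : (∃[ δ ] 0ℚ <ℚ δ × ∃[ N ] ∀ n → N ℕ.≤ n → δ ≤ℚ seq x n) →
         (∃[ δ ] 0ℚ <ℚ δ × ∃[ N ] ∀ n → N ℕ.≤ n → δ ≤ℚ seq y n) → 0ℝ < x * y
    go (δ , 0<δ , N , δ≤x) (ε , 0<ε , M , ε≤y) = mk-0< {x * y} (δ *ℚ ε) (N ℕ.⊔ M) (0<* 0<δ 0<ε) λ n p →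
      *-mono (ℚ.<⇒≤ 0<ε) (ℚ.≤-trans (ℚ.<⇒≤ 0<δ) (δ≤x n (ℕ.m⊔n≤o⇒m≤o N M p)))
        (δ≤x n (ℕ.m⊔n≤o⇒m≤o N M p)) (ε≤y n (ℕ.m⊔n≤o⇒n≤o N M p))

  ^-pos : ∀ {x} k → 0ℝ < x → 0ℝ < x ^ k
  ^-pos zero    0<x = 0<1ℝ
  ^-pos {x} (suc k) 0<x = *-pos {x} {x ^ k} 0<x (^-pos {x} k 0<x)

  ⁻¹-pos : ∀ {x} (0<x : 0ℝ < x) → 0ℝ < x ⁻¹[ 0<x ]
  ⁻¹-pos {x} 0<x = go (bounded-below {x} 0<x) (Cauchy-Lemmas.bounded (cauchy x))
    where
    go : (∃[ δ ] 0ℚ <ℚ δ × ∃[ N ] ∀ n → N ℕ.≤ n → δ ≤ℚ seq x n) →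
         (∃[ B ] 0ℚ <ℚ B × ∃[ N ] ∀ n → N ℕ.≤ n → ∣ seq x n ∣ℚ ≤ℚ B) → 0ℝ < x ⁻¹[ 0<x ]
    go (δ , 0<δ , N , δ≤x) (B , 0<B , M , x≤B) = mk-0< {x ⁻¹[ 0<x ]} (recip B) (N ℕ.⊔ M) (0<recip 0<B) λ n p →
      recip-antimono (ℚ.<-≤-trans 0<δ (δ≤x n (ℕ.m⊔n≤o⇒m≤o N M p)))
        (ℚ.≤-trans (p≤∣p∣ (seq x n)) (x≤B n (ℕ.m⊔n≤o⇒n≤o N M p)))

  x+1-pos : ∀ {x} → 0ℝ < x → 0ℝ < x + 1ℝ
  x+1-pos {x} (δ , 0<δ , N , δ≤x) = δ , 0<δ , N , λ n N≤n → begin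
    0ℚ +ℚ δ             ≤⟨ δ≤x n N≤n ⟩
    seq x n             ≡⟨ ℚ.+-identityʳ (seq x n) ⟨
    seq x n +ℚ 0ℚ       ≤⟨ ℚ.+-monoʳ-≤ (seq x n) 0≤1 ⟩
    seq x n +ℚ 1ℚ       ∎

  1<⇒0< : ∀ {x} → 1ℝ < x → 0ℝ < x
  1<⇒0< {x} (δ , 0<δ , N , p) = δ , 0<δ , N , λ n N≤n → ℚ.≤-trans (ℚ.+-monoˡ-≤ δ 0≤1) (p n N≤n)

  1<⇒0<x-1 : ∀ {x} → 1ℝ < x → 0ℝ < x - 1ℝ
  1<⇒0<x-1 {x} (δ , 0<δ , N , p) = mk-0< {x - 1ℝ} δ N 0<δ λ n N≤n →
    subst (_≤ℚ seq x n -ℚ 1ℚ) (solve 1 (λ δ → (con 1ℚ :+ δ) :- con 1ℚ := δ) refl δ)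
      (ℚ.+-monoˡ-≤ (-ℚ 1ℚ) (p n N≤n))

  artanh-pos : ∀ {y} (∣y∣<1 : ∣ y ∣ < 1ℝ) → 0ℝ < y → 0ℝ < artanh y ∣y∣<1
  artanh-pos {y} ∣y∣<1 0<y = go (bounded-below {y} 0<y)
    where
    go : (∃[ δ ] 0ℚ <ℚ δ × ∃[ N ] ∀ n → N ℕ.≤ n → δ ≤ℚ seq y n) → 0ℝ < artanh y ∣y∣<1
    go (δ , 0<δ , N , δ≤y) = mk-0< {artanh y ∣y∣<1} δ (1 ℕ.⊔ N) 0<δ λ n p →
      let δ≤yₙ = δ≤y n (ℕ.m⊔n≤o⇒n≤o 1 N p) in
      ℚ.≤-trans δ≤yₙ (Artanh-Lemmas.sum-positive n (ℚ.≤-trans (ℚ.<⇒≤ 0<δ) δ≤yₙ) (ℕ.m⊔n≤o⇒m≤o 1 N p))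

  -- If 0 < δ ≤ x ≤ B and δ′ = min δ 1, then ∣(x - 1)/(x + 1)∣ ≤ 1 - δ′/(B + 1).
  ratio<1 : ∀ {x} (0<x : 0ℝ < x) → ∣ (x - 1ℝ) / (x + 1ℝ) [ x+1-pos {x} 0<x ] ∣ < 1ℝ
  ratio<1 {x} 0<x = go (bounded-below {x} 0<x) (Cauchy-Lemmas.bounded (cauchy x))
    where
    go : (∃[ δ ] 0ℚ <ℚ δ × ∃[ N ] ∀ n → N ℕ.≤ n → δ ≤ℚ seq x n) →
         (∃[ B ] 0ℚ <ℚ B × ∃[ N ] ∀ n → N ℕ.≤ n → ∣ seq x n ∣ℚ ≤ℚ B) →
         ∣ (x - 1ℝ) / (x + 1ℝ) [ x+1-pos {x} 0<x ] ∣ < 1ℝ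
    go (δ , 0<δ , N , δ≤x) (B , 0<B , M , x≤B) = η , 0<η , N ℕ.⊔ M , λ n p →
      final (seq x n) (δ≤x n (ℕ.m⊔n≤o⇒m≤o N M p))
        (ℚ.≤-trans (p≤∣p∣ (seq x n)) (x≤B n (ℕ.m⊔n≤o⇒n≤o N M p)))
      where
      δ′ = δ ℚ.⊓ 1ℚ
      0<δ′ : 0ℚ <ℚ δ′
      0<δ′ with ℚ.⊓-sel δ 1ℚ
      ... | inj₁ eq = subst (0ℚ <ℚ_) (sym eq) 0<δ
      ... | inj₂ eq = subst (0ℚ <ℚ_) (sym eq) 0<1
      0<B+1 = 0<+ 0<B 0≤1
      η = δ′ *ℚ recip (B +ℚ 1ℚ)
      0<η = 0<* 0<δ′ (0<recip 0<B+1)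
      final : ∀ q → δ ≤ℚ q → q ≤ℚ B → ∣ (q -ℚ 1ℚ) *ℚ recip (q +ℚ 1ℚ) ∣ℚ +ℚ η ≤ℚ 1ℚ
      final q δ≤q q≤B = subst (∣ (q -ℚ 1ℚ) *ℚ k ∣ℚ +ℚ η ≤ℚ_) (solve 1 (λ η → (con 1ℚ :- η) :+ η := con 1ℚ) refl η)
        (ℚ.+-monoˡ-≤ η (∣p∣≤ upper lower))
        where
        k = recip (q +ℚ 1ℚ)
        0<q = ℚ.<-≤-trans 0<δ δ≤q
        0<q+1 = 0<+ 0<q 0≤1
        0≤k = ℚ.<⇒≤ (0<recip 0<q+1)
        η[q+1]≤δ′ : η *ℚ (q +ℚ 1ℚ) ≤ℚ δ′
        η[q+1]≤δ′ = begin
          η *ℚ (q +ℚ 1ℚ)                              ≤⟨ *-monoˡ η (ℚ.<⇒≤ 0<η) (ℚ.+-monoˡ-≤ 1ℚ q≤B) ⟩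
          δ′ *ℚ recip (B +ℚ 1ℚ) *ℚ (B +ℚ 1ℚ)          ≡⟨ solve 3 (λ a b c → a :* b :* c := a :* (c :* b)) refl δ′ (recip (B +ℚ 1ℚ)) (B +ℚ 1ℚ) ⟩
          δ′ *ℚ ((B +ℚ 1ℚ) *ℚ recip (B +ℚ 1ℚ))        ≡⟨ cong (δ′ *ℚ_) (recip-inverse 0<B+1) ⟩
          δ′ *ℚ 1ℚ                                    ≡⟨ ℚ.*-identityʳ δ′ ⟩
          δ′                                          ∎
        bound : ∀ z → z +ℚ η *ℚ (q +ℚ 1ℚ) ≤ℚ q +ℚ 1ℚ → z *ℚ k ≤ℚ 1ℚ -ℚ η
        bound z h = begin
          z *ℚ k                                      ≡⟨ solve 3 (λ z c k → z :* k := ((z :+ c) :- c) :* k) refl z (η *ℚ (q +ℚ 1ℚ)) k ⟩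
          ((z +ℚ η *ℚ (q +ℚ 1ℚ)) -ℚ η *ℚ (q +ℚ 1ℚ)) *ℚ k ≤⟨ *-monoʳ k 0≤k (ℚ.+-monoˡ-≤ (-ℚ (η *ℚ (q +ℚ 1ℚ))) h) ⟩
          ((q +ℚ 1ℚ) -ℚ η *ℚ (q +ℚ 1ℚ)) *ℚ k          ≡⟨ solve 3 (λ u η k → (u :- η :* u) :* k := (con 1ℚ :- η) :* (u :* k)) refl (q +ℚ 1ℚ) η k ⟩
          (1ℚ -ℚ η) *ℚ ((q +ℚ 1ℚ) *ℚ k)               ≡⟨ cong ((1ℚ -ℚ η) *ℚ_) (recip-inverse 0<q+1) ⟩
          (1ℚ -ℚ η) *ℚ 1ℚ                             ≡⟨ ℚ.*-identityʳ (1ℚ -ℚ η) ⟩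
          1ℚ -ℚ η                                     ∎
        upper : (q -ℚ 1ℚ) *ℚ k ≤ℚ 1ℚ -ℚ η
        upper = bound (q -ℚ 1ℚ) (begin
          (q -ℚ 1ℚ) +ℚ η *ℚ (q +ℚ 1ℚ)   ≤⟨ ℚ.+-monoʳ-≤ (q -ℚ 1ℚ) (ℚ.≤-trans η[q+1]≤δ′ (ℚ.p⊓q≤q δ 1ℚ)) ⟩
          (q -ℚ 1ℚ) +ℚ 1ℚ               ≤⟨ ℚ.+-monoˡ-≤ 1ℚ (ℚ.≤-trans (ℚ.+-monoʳ-≤ q (ℚ.neg-antimono-≤ 0≤1)) (ℚ.≤-reflexive (ℚ.+-identityʳ q))) ⟩
          q +ℚ 1ℚ                       ∎)
        lower : -ℚ ((q -ℚ 1ℚ) *ℚ k) ≤ℚ 1ℚ -ℚ η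
        lower = subst (_≤ℚ 1ℚ -ℚ η) (solve 2 (λ q k → (con 1ℚ :- q) :* k := :- ((q :- con 1ℚ) :* k)) refl q k)
          (bound (1ℚ -ℚ q) (begin
            (1ℚ -ℚ q) +ℚ η *ℚ (q +ℚ 1ℚ)   ≤⟨ ℚ.+-monoʳ-≤ (1ℚ -ℚ q) (ℚ.≤-trans η[q+1]≤δ′ (ℚ.≤-trans (ℚ.p⊓q≤p δ 1ℚ) δ≤q)) ⟩
            (1ℚ -ℚ q) +ℚ q                ≡⟨ solve 1 (λ q → (con 1ℚ :- q) :+ q := con 1ℚ) refl q ⟩
            1ℚ                            ≡⟨ ℚ.+-identityˡ 1ℚ ⟨
            0ℚ +ℚ 1ℚ                      ≤⟨ ℚ.+-monoˡ-≤ 1ℚ (ℚ.<⇒≤ 0<q) ⟩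
            q +ℚ 1ℚ                       ∎))

-- The natural logarithm: artanh y = ½ log ((1 + y) / (1 - y)), and (1 + y) / (1 - y) = x
-- when y = (x - 1) / (x + 1).
log : (x : ℝ) → 0ℝ < x → ℝ
log x 0<x = fromℕ 2 * artanh ((x - 1ℝ) / (x + 1ℝ) [ Positivity.x+1-pos {x} 0<x ]) (Positivity.ratio<1 {x} 0<x)

log-pos : ∀ {x} (0<x : 0ℝ < x) → 1ℝ < x → 0ℝ < log x 0<x
log-pos {x} 0<x 1<x = *-pos {fromℕ 2} {artanh y y<1} 0<2 (artanh-pos {y} y<1 0<y)
  where
  open Positivity
  y = (x - 1ℝ) / (x + 1ℝ) [ x+1-pos {x} 0<x ]
  y<1 = ratio<1 {x} 0<x
  0<y : 0ℝ < y
  0<y = *-pos {x - 1ℝ} {(x + 1ℝ) ⁻¹[ x+1-pos {x} 0<x ]} (1<⇒0<x-1 {x} 1<x) (⁻¹-pos {x + 1ℝ} (x+1-pos {x} 0<x))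
  0<2 : 0ℝ < fromℕ 2
  0<2 = mk-0< {fromℕ 2} 1ℚ 0 ℚ-Lemmas.0<1 λ _ _ → ℚ-Lemmas.1≤fromℕℚ-suc 1

-- A real number x > 1 together with its integer part. The integer part is a field because it
-- cannot be computed from a Cauchy sequence; classically every real number has one.
record Point : Set where
  field
    value         : ℝ
    1<value       : 1ℝ < value
    ⌊value⌋       : ℕ
    ⌊value⌋≤value : fromℕ ⌊value⌋ ≤ value
    value<⌊value⌋+1 : value < fromℕ (suc ⌊value⌋)

  0<value : 0ℝ < value
  0<value = Positivity.1<⇒0< {value} 1<value

-- f(x) ∼ g(x) as x → ∞, i.e. f - g = o(g)
infix 4 _∼_

_∼_ : (f g : Point → ℝ) → Set
f ∼ g = ∀ ε → 0ℚ ℚ.< ε → ∃[ X ] ∀ t → X ≤ Point.value t → ∣ f t - g t ∣ ≤ fromℚ ε * ∣ g t ∣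

-- c x / logᵏ x
mainTerm : ℝ → ℕ → Point → ℝ
mainTerm c k t =
  c * value / log value 0<value ^ k [ Positivity.^-pos {log value 0<value} k (log-pos {value} 0<value 1<value) ]
  where open Point t

-- Negative integers are not prime.
Primeℤ : ℤ → Set
Primeℤ (ℤ.+ n)    = Prime n
Primeℤ ℤ.-[1+ _ ] = ⊥

primeℤ? : ∀ z → Dec (Primeℤ z)
primeℤ? (ℤ.+ n)    = prime? n
primeℤ? ℤ.-[1+ _ ] = no λ ()

module _ {k : ℕ} (a : Fin k → ℕ) (b : Fin k → ℤ) where

  linearForm : Fin k → ℕ → ℤ
  linearForm i m = ℤ.+ a i ℤ.* ℤ.+ m ℤ.+ b i

  formProduct : ℕ → ℤ
  formProduct m = Vector.foldr ℤ._*_ (ℤ.+ 1) (λ i → linearForm i m)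

  -- P(x), as a function of ⌊x⌋
  primeTupleCount : ℕ → ℕ
  primeTupleCount n =
    length (filter (λ m → Fin.all? λ i → primeℤ? (linearForm i m)) (map suc (upTo n)))

-- The forms aᵢ m + bᵢ are taken pairwise distinct. This is tacit in the usual statement, which is
-- otherwise false: repeating a form raises the power of log x without changing P(x). Results that
-- assume this version also follow from the one without the restriction.
PrimeKTuplesConjecture : Set
PrimeKTuplesConjecture =
  ∀ (k : ℕ) .{{_ : ℕ.NonZero k}} (a : Fin k → ℕ) (b : Fin k → ℤ) →
  (∀ i → 0 ℕ.< a i) →
  (∀ i → b i ≢ ℤ.+ 0) →
  (∀ i j → a i ≡ a j → b i ≡ b j → i ≡ j) →
  ¬ (∃[ p ] Prime p × ∀ m → 1 ℕ.≤ m → ℤ.+ p ℤ.∣ formProduct a b m) →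
  ∃[ c ] 0ℝ < c × (λ t → fromℕ (primeTupleCount a b (Point.⌊value⌋ t))) ∼ mainTerm c k

record LucasCarmichael (n : ℕ) : Set where
  field
    squareFree : ∀ d → d ℕ.* d ∣ n → d ≡ 1
    composite  : Composite n
    p+1∣n+1    : ∀ p → Prime p → p ∣ n → p ℕ.+ 1 ∣ n ℕ.+ 1

-- For n > 0, the distinct prime divisors of n.
primeDivisors : ℕ → List ℕ
primeDivisors n = filter (λ p → prime? p ×-dec (p ∣? n)) (upTo (suc n))

digitSum : (b : ℕ) {b≥2 : True (2 ℕ.≤? b)} → ℕ → ℕ
digitSum b {b≥2} N = sum (map Fin.toℕ (proj₁ (toDigits b {b≥2} N)))

-- The division is exact for Lucas-Carmichael n, because S_{p+2}(n+2) ≡ n + 2 ≡ 1 modulo p + 1.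
degree : ℕ → ℕ
degree n = max 0 (map (λ p → (digitSum (2 ℕ.+ p) (n ℕ.+ 2) ℕ.∸ 1) ℕ./ suc p) (primeDivisors n))

{-# OPTIONS --safe #-}

-- If p = 6m - 1, q = 12m - 1 and r = 18m - 1 are prime, then n = pqr is a Lucas-Carmichael number,
-- since n + 1 = 36m (36m² - 11m + 1). For m ≥ 8 the digits of n + 2, most significant first, are
--   5, 6m - 28, 45, 6m - 21     in base p + 2,
--   9m - 5, 9m + 11, 6m - 5     in base q + 2,
--   4m - 2, 6m + 5, 8m - 2      in base r + 2,
-- so that the quotients (S(n + 2) - 1) / (p + 1), etc., are 2, 2 and 1, and the degree is 2.
--
-- The three forms are admissible: their products at m = 1 and m = 5 are coprime. For the conjecture
-- to produce arbitrarily large m it remains to see that c x / logᵏ x is unbounded. Along x = 2ʲ this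
-- follows from log (2ʲ) ≤ 2j + 4, which is obtained by splitting the artanh series dyadically.
module Submission where

module Analysis where

  open import Data.Nat.Base as ℕ using (ℕ; zero; suc)
  import Data.Nat.Properties as ℕ
  open import Data.Nat.Tactic.RingSolver using (solve-∀)
  open import Data.Product.Base using (∃-syntax; _×_; _,_; proj₁; proj₂)
  open import Data.Rational.Base as ℚ using (ℚ; 0ℚ; 1ℚ; _≤_; _<_; _+_; _*_; _-_; -_; ∣_∣)
  import Data.Rational.Properties as ℚ
  open import Data.Rational.Solver using (module +-*-Solver)
  open import Relation.Binary.PropositionalEquality
    using (_≡_; refl; sym; trans; cong; subst; subst₂; module ≡-Reasoning)
  open import Defs as D hiding (_≤_; _<_; _+_; _*_; _-_; -_; ∣_∣)
  open ℚ-Lemmas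
  open +-*-Solver using (solve; _:=_; _:+_; _:*_; _:-_; con)

  -- Rational arithmetic: the embedding of ℕ, reciprocals, powers.

  fromℕℚ-+ : ∀ m n → fromℕℚ (m ℕ.+ n) ≡ fromℕℚ m + fromℕℚ n
  fromℕℚ-+ zero    n = sym (ℚ.+-identityˡ (fromℕℚ n))
  fromℕℚ-+ (suc m) n = begin
    fromℕℚ (suc (m ℕ.+ n))          ≡⟨ fromℕℚ-suc (m ℕ.+ n) ⟩
    1ℚ + fromℕℚ (m ℕ.+ n)           ≡⟨ cong (1ℚ +_) (fromℕℚ-+ m n) ⟩
    1ℚ + (fromℕℚ m + fromℕℚ n)      ≡⟨ ℚ.+-assoc 1ℚ (fromℕℚ m) (fromℕℚ n) ⟨
    1ℚ + fromℕℚ m + fromℕℚ n        ≡⟨ cong (_+ fromℕℚ n) (fromℕℚ-suc m) ⟨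
    fromℕℚ (suc m) + fromℕℚ n       ∎
    where open ≡-Reasoning

  fromℕℚ-* : ∀ m n → fromℕℚ (m ℕ.* n) ≡ fromℕℚ m * fromℕℚ n
  fromℕℚ-* zero    n = sym (ℚ.*-zeroˡ (fromℕℚ n))
  fromℕℚ-* (suc m) n = begin
    fromℕℚ (n ℕ.+ m ℕ.* n)                  ≡⟨ fromℕℚ-+ n (m ℕ.* n) ⟩
    fromℕℚ n + fromℕℚ (m ℕ.* n)             ≡⟨ cong (fromℕℚ n +_) (fromℕℚ-* m n) ⟩
    fromℕℚ n + fromℕℚ m * fromℕℚ n          ≡⟨ solve 2 (λ m n → n :+ m :* n := (con 1ℚ :+ m) :* n) refl (fromℕℚ m) (fromℕℚ n) ⟩
    (1ℚ + fromℕℚ m) * fromℕℚ n              ≡⟨ cong (_* fromℕℚ n) (fromℕℚ-suc m) ⟨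
    fromℕℚ (suc m) * fromℕℚ n               ∎
    where open ≡-Reasoning

  fromℕℚ-^ : ∀ m k → fromℕℚ (m ℕ.^ k) ≡ fromℕℚ m ^ℚ k
  fromℕℚ-^ m zero    = refl
  fromℕℚ-^ m (suc k) = trans (fromℕℚ-* m (m ℕ.^ k)) (cong (fromℕℚ m *_) (fromℕℚ-^ m k))

  fromℕℚ-mono-≤ : ∀ {m n} → m ℕ.≤ n → fromℕℚ m ≤ fromℕℚ n
  fromℕℚ-mono-≤ {m} {n} m≤n = begin
    fromℕℚ m                    ≡⟨ ℚ.+-identityʳ (fromℕℚ m) ⟨
    fromℕℚ m + 0ℚ               ≤⟨ ℚ.+-monoʳ-≤ (fromℕℚ m) (0≤fromℕℚ (n ℕ.∸ m)) ⟩
    fromℕℚ m + fromℕℚ (n ℕ.∸ m) ≡⟨ fromℕℚ-+ m (n ℕ.∸ m) ⟨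
    fromℕℚ (m ℕ.+ (n ℕ.∸ m))    ≡⟨ cong fromℕℚ (ℕ.m+[n∸m]≡n m≤n) ⟩
    fromℕℚ n                    ∎
    where open ℚ.≤-Reasoning

  fromℕℚ-cancel-≤ : ∀ {m n} → fromℕℚ m ≤ fromℕℚ n → m ℕ.≤ n
  fromℕℚ-cancel-≤ {m} {n} p = ℕ.≮⇒≥ λ n<m → ℚ.<-irrefl refl (ℚ.<-≤-trans (n<1+n n) (ℚ.≤-trans (fromℕℚ-mono-≤ n<m) p))
    where
    n<1+n : ∀ n → fromℕℚ n < fromℕℚ (suc n)
    n<1+n n = subst₂ _<_ (ℚ.+-identityˡ (fromℕℚ n)) (sym (fromℕℚ-suc n)) (ℚ.+-monoˡ-< (fromℕℚ n) 0<1)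

  recip-≤ : ∀ {p q} → 0ℚ < p → 1ℚ ≤ p * q → recip p ≤ q
  recip-≤ {p} {q} 0<p 1≤pq = begin
    recip p            ≡⟨ ℚ.*-identityʳ (recip p) ⟨
    recip p * 1ℚ       ≤⟨ *-monoˡ (recip p) (ℚ.<⇒≤ (0<recip 0<p)) 1≤pq ⟩
    recip p * (p * q)  ≡⟨ solve 3 (λ r p q → r :* (p :* q) := p :* r :* q) refl (recip p) p q ⟩
    p * recip p * q    ≡⟨ cong (_* q) (recip-inverse 0<p) ⟩
    1ℚ * q             ≡⟨ ℚ.*-identityˡ q ⟩
    q                  ∎
    where open ℚ.≤-Reasoning

  ^-mono-≤ : ∀ {p q} k → 0ℚ ≤ p → p ≤ q → p ^ℚ k ≤ q ^ℚ k
  ^-mono-≤ zero    0≤p p≤q = ℚ.≤-refl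
  ^-mono-≤ (suc k) 0≤p p≤q = *-mono (0≤^ k 0≤p) (ℚ.≤-trans 0≤p p≤q) p≤q (^-mono-≤ k 0≤p p≤q)

  0<^ : ∀ {p} k → 0ℚ < p → 0ℚ < p ^ℚ k
  0<^ zero    0<p = 0<1
  0<^ (suc k) 0<p = 0<* 0<p (0<^ k 0<p)

  geometric≤n : ∀ {y} n → 0ℚ ≤ y → y ≤ 1ℚ → geometric y n ≤ fromℕℚ n
  geometric≤n zero    0≤y y≤1 = ℚ.≤-refl
  geometric≤n {y} (suc n) 0≤y y≤1 = begin
    geometric y n + y ^ℚ n  ≤⟨ ℚ.+-mono-≤ (geometric≤n n 0≤y y≤1) (^-antimono 0≤y y≤1 (ℕ.z≤n {n})) ⟩
    fromℕℚ n + 1ℚ           ≡⟨ ℚ.+-comm (fromℕℚ n) 1ℚ ⟩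
    1ℚ + fromℕℚ n           ≡⟨ fromℕℚ-suc n ⟨
    fromℕℚ (suc n)          ∎
    where open ℚ.≤-Reasoning

  -- Partial sums of the artanh series.

  module _ {y : ℚ} (0≤y : 0ℚ ≤ y) (y≤1 : y ≤ 1ℚ) where
    open Artanh-Lemmas using (weight; 0≤weight)
    open ℚ.≤-Reasoning

    -- The exponent drops from 2(K + i) + 1 to i and the weight is frozen at its value for `K`. Both
    -- changes can only enlarge the term, and they leave a geometric series.
    artanhTerm-+ : ∀ K i → artanhTerm y (K ℕ.+ i) ≤ y ^ℚ i * weight K
    artanhTerm-+ K i = *-mono (0≤weight (K ℕ.+ i)) (0≤^ i 0≤y)
      (^-antimono 0≤y y≤1 i≤)
      (recip-antimono (0<fromℕℚ-suc (2 ℕ.* K))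
        (fromℕℚ-mono-≤ (ℕ.s≤s (ℕ.*-monoʳ-≤ 2 (ℕ.m≤m+n K i)))))
      where
      i≤ : i ℕ.≤ suc (2 ℕ.* (K ℕ.+ i))
      i≤ = ℕ.m≤n⇒m≤1+n (ℕ.≤-trans (ℕ.m≤n+m i K) (ℕ.m≤n*m (K ℕ.+ i) 2))

    artanhSum-+ : ∀ K n → artanhSum y (K ℕ.+ n) ≤ artanhSum y K + geometric y n * weight K
    artanhSum-+ K zero = ℚ.≤-reflexive (begin-equality
      artanhSum y (K ℕ.+ 0)               ≡⟨ cong (artanhSum y) (ℕ.+-identityʳ K) ⟩
      artanhSum y K                       ≡⟨ solve 2 (λ S w → S := S :+ con 0ℚ :* w) refl (artanhSum y K) (weight K) ⟩
      artanhSum y K + 0ℚ * weight K       ∎)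
    artanhSum-+ K (suc n) = begin
      artanhSum y (K ℕ.+ suc n)
        ≡⟨ cong (artanhSum y) (ℕ.+-suc K n) ⟩
      artanhSum y (K ℕ.+ n) + artanhTerm y (K ℕ.+ n)
        ≤⟨ ℚ.+-mono-≤ (artanhSum-+ K n) (artanhTerm-+ K n) ⟩
      artanhSum y K + geometric y n * weight K + y ^ℚ n * weight K
        ≡⟨ solve 4 (λ S G R w → S :+ G :* w :+ R :* w := S :+ (G :+ R) :* w) refl (artanhSum y K) (geometric y n) (y ^ℚ n) (weight K) ⟩
      artanhSum y K + geometric y (suc n) * weight K ∎

    artanhSum-+≤ : ∀ K n → geometric y n ≤ fromℕℚ (suc K) → artanhSum y (K ℕ.+ n) ≤ artanhSum y K + 1ℚ
    artanhSum-+≤ K n G≤ = ℚ.≤-trans (artanhSum-+ K n) (ℚ.+-monoʳ-≤ (artanhSum y K) (begin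
      geometric y n * weight K             ≤⟨ *-monoʳ (weight K) (0≤weight K) (ℚ.≤-trans G≤ (fromℕℚ-mono-≤ (ℕ.s≤s (ℕ.m≤n*m K 2)))) ⟩
      fromℕℚ (suc (2 ℕ.* K)) * weight K    ≡⟨ recip-inverse (0<fromℕℚ-suc (2 ℕ.* K)) ⟩
      1ℚ                                   ∎))

    -- Doubling the number of terms adds a block of 2ʲ terms starting at index 2ʲ. Its geometric sum
    -- is at most 2ʲ, so each doubling costs at most 1.
    artanhSum-2^ : ∀ j → artanhSum y (2 ℕ.^ j) ≤ fromℕℚ (suc j)
    artanhSum-2^ zero = begin
      artanhSum y 1                       ≤⟨ artanhSum-+≤ 0 1 (geometric≤n 1 0≤y y≤1) ⟩
      0ℚ + 1ℚ                             ≡⟨⟩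
      fromℕℚ 1                            ∎
    artanhSum-2^ (suc j) = begin
      artanhSum y (2 ℕ.^ j ℕ.+ (2 ℕ.^ j ℕ.+ 0))   ≡⟨ cong (λ k → artanhSum y (2 ℕ.^ j ℕ.+ k)) (ℕ.+-identityʳ (2 ℕ.^ j)) ⟩
      artanhSum y (2 ℕ.^ j ℕ.+ 2 ℕ.^ j)           ≤⟨ artanhSum-+≤ (2 ℕ.^ j) (2 ℕ.^ j) (ℚ.≤-trans (geometric≤n (2 ℕ.^ j) 0≤y y≤1) (fromℕℚ-mono-≤ (ℕ.n≤1+n (2 ℕ.^ j)))) ⟩
      artanhSum y (2 ℕ.^ j) + 1ℚ                  ≤⟨ ℚ.+-monoˡ-≤ 1ℚ (artanhSum-2^ j) ⟩
      fromℕℚ (suc j) + 1ℚ                         ≡⟨ ℚ.+-comm (fromℕℚ (suc j)) 1ℚ ⟩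
      1ℚ + fromℕℚ (suc j)                         ≡⟨ fromℕℚ-suc (suc j) ⟨
      fromℕℚ (suc (suc j))                        ∎

  -- The argument of artanh in log q = 2 artanh (ratio q); the approximations of `log` at a constant
  -- sequence unfold to it.
  ratio : ℚ → ℚ
  ratio q = (q - 1ℚ) * recip (q + 1ℚ)

  module _ {q : ℚ} (1≤q : 1ℚ ≤ q) where
    open ℚ.≤-Reasoning

    0<q+1 : 0ℚ < q + 1ℚ
    0<q+1 = ℚ.<-≤-trans 0<1 (subst (_≤ q + 1ℚ) (ℚ.+-identityˡ 1ℚ) (ℚ.+-monoˡ-≤ 1ℚ (ℚ.≤-trans 0≤1 1≤q)))

    -- This is 1 - ratio q, in a form whose reciprocal is visibly (q + 1)/2.
    η : ℚ
    η = (1ℚ + 1ℚ) * recip (q + 1ℚ)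

    0<η : 0ℚ < η
    0<η = 0<* {1ℚ + 1ℚ} (0<+ 0<1 0≤1) (0<recip 0<q+1)

    0≤ratio : 0ℚ ≤ ratio q
    0≤ratio = 0≤* (subst (_≤ q - 1ℚ) (ℚ.+-inverseʳ 1ℚ) (ℚ.+-monoˡ-≤ (- 1ℚ) 1≤q)) (ℚ.<⇒≤ (0<recip 0<q+1))

    ratio+η : ratio q + η ≡ 1ℚ
    ratio+η = trans
      (solve 2 (λ q r → (q :- con 1ℚ) :* r :+ (con 1ℚ :+ con 1ℚ) :* r := (q :+ con 1ℚ) :* r) refl q (recip (q + 1ℚ)))
      (recip-inverse 0<q+1)

    ratio≤1 : ratio q ≤ 1ℚ
    ratio≤1 = subst₂ _≤_ (ℚ.+-identityʳ (ratio q)) ratio+η (ℚ.+-monoʳ-≤ (ratio q) (ℚ.<⇒≤ 0<η))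

    -- The infinite series has sum 1/η = (q + 1)/2, and a factor of 2 is given away. The bound is
    -- uniform in `n`, as the tail requires.
    geometric-ratio : ∀ n → geometric (ratio q) n ≤ 1ℚ + q
    geometric-ratio n = ℚ.≤-trans (geometric≤ n 0≤ratio 0<η ratio+η) (recip-≤ 0<η (begin
      1ℚ                                        ≤⟨ 1≤fromℕℚ-suc 1 ⟩
      1ℚ + 1ℚ                                   ≡⟨ ℚ.*-identityʳ (1ℚ + 1ℚ) ⟨
      (1ℚ + 1ℚ) * 1ℚ                            ≡⟨ cong ((1ℚ + 1ℚ) *_) (recip-inverse 0<q+1) ⟨
      (1ℚ + 1ℚ) * ((q + 1ℚ) * recip (q + 1ℚ))   ≡⟨ solve 2 (λ q r → (con 1ℚ :+ con 1ℚ) :* ((q :+ con 1ℚ) :* r) := (con 1ℚ :+ con 1ℚ) :* r :* (con 1ℚ :+ q)) refl q (recip (q + 1ℚ)) ⟩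
      η * (1ℚ + q)                              ∎))

  -- The partial sums of log (2ʲ) = 2 artanh ((2ʲ - 1) / (2ʲ + 1)).
  logSum-2^ : ∀ j n → 2 ℕ.^ j ℕ.≤ n → fromℕℚ 2 * artanhSum (ratio (fromℕℚ (2 ℕ.^ j))) n ≤ fromℕℚ (2 ℕ.* (2 ℕ.+ j))
  logSum-2^ j n 2^j≤n = begin
    fromℕℚ 2 * artanhSum y n              ≤⟨ *-monoˡ (fromℕℚ 2) (0≤fromℕℚ 2) bound ⟩
    fromℕℚ 2 * fromℕℚ (2 ℕ.+ j)           ≡⟨ fromℕℚ-* 2 (2 ℕ.+ j) ⟨
    fromℕℚ (2 ℕ.* (2 ℕ.+ j))              ∎
    where
    open ℚ.≤-Reasoning
    K = 2 ℕ.^ j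
    y = ratio (fromℕℚ K)
    1≤K : 1ℚ ≤ fromℕℚ K
    1≤K = fromℕℚ-mono-≤ (ℕ.m^n>0 2 j)
    bound : artanhSum y n ≤ fromℕℚ (2 ℕ.+ j)
    bound = begin
      artanhSum y n                     ≡⟨ cong (artanhSum y) (ℕ.m+[n∸m]≡n 2^j≤n) ⟨
      -- Beyond index 2ʲ it is the ratio, not the number of terms, that controls the geometric sum:
      -- it stays at most 2ʲ + 1, so the whole tail costs at most 1.
      artanhSum y (K ℕ.+ (n ℕ.∸ K))     ≤⟨ artanhSum-+≤ (0≤ratio 1≤K) (ratio≤1 1≤K) K (n ℕ.∸ K) (ℚ.≤-trans (geometric-ratio 1≤K (n ℕ.∸ K)) (ℚ.≤-reflexive (sym (fromℕℚ-suc K)))) ⟩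
      artanhSum y K + 1ℚ                ≤⟨ ℚ.+-monoˡ-≤ 1ℚ (artanhSum-2^ (0≤ratio 1≤K) (ratio≤1 1≤K) j) ⟩
      fromℕℚ (suc j) + 1ℚ               ≡⟨ ℚ.+-comm (fromℕℚ (suc j)) 1ℚ ⟩
      1ℚ + fromℕℚ (suc j)               ≡⟨ fromℕℚ-suc (suc j) ⟨
      fromℕℚ (2 ℕ.+ j)                  ∎

  -- Exponentials against polynomials.

  n<2^n : ∀ n → n ℕ.< 2 ℕ.^ n
  n<2^n zero    = ℕ.≤-refl
  n<2^n (suc n) = begin
    suc (suc n)                ≤⟨ ℕ.+-mono-≤ (ℕ.m^n>0 2 n) (n<2^n n) ⟩
    2 ℕ.^ n ℕ.+ 2 ℕ.^ n        ≡⟨ cong (2 ℕ.^ n ℕ.+_) (ℕ.+-identityʳ (2 ℕ.^ n)) ⟨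
    2 ℕ.^ suc n                ∎
    where open ℕ.≤-Reasoning

  -- The exponents compare since A + 2k (u + 1) ≤ (u + 1)² ≤ 2²ᵘ = j.
  exponential-dominates-at : ∀ A k u {j} → 0 ℕ.< u → A ℕ.+ 2 ℕ.* k ℕ.≤ u → j ≡ 2 ℕ.^ (2 ℕ.* u) →
                             A ℕ.* (2 ℕ.* (2 ℕ.+ j)) ℕ.^ k ℕ.≤ 2 ℕ.^ j
  exponential-dominates-at A k u {j} 0<u A+2k≤u j≡ = begin
    -- Each factor is bounded by a power of 2: A ≤ 2^A and 2(2 + j) ≤ 4j = 2^(2(u + 1)).
    A ℕ.* (2 ℕ.* (2 ℕ.+ j)) ℕ.^ k                 ≤⟨ ℕ.*-mono-≤ (ℕ.<⇒≤ (n<2^n A)) (ℕ.^-monoˡ-≤ k 2[2+j]≤) ⟩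
    2 ℕ.^ A ℕ.* (2 ℕ.^ (2 ℕ.* suc u)) ℕ.^ k       ≡⟨ cong (2 ℕ.^ A ℕ.*_) (ℕ.^-*-assoc 2 (2 ℕ.* suc u) k) ⟩
    2 ℕ.^ A ℕ.* 2 ℕ.^ (2 ℕ.* suc u ℕ.* k)         ≡⟨ ℕ.^-distribˡ-+-* 2 A (2 ℕ.* suc u ℕ.* k) ⟨
    2 ℕ.^ (A ℕ.+ 2 ℕ.* suc u ℕ.* k)               ≤⟨ ℕ.^-monoʳ-≤ 2 exponent ⟩
    2 ℕ.^ j                                       ∎
    where
    open ℕ.≤-Reasoning
    [1+u]²≤j : suc u ℕ.* suc u ℕ.≤ j
    [1+u]²≤j = begin
      suc u ℕ.* suc u          ≤⟨ ℕ.*-mono-≤ (n<2^n u) (n<2^n u) ⟩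
      2 ℕ.^ u ℕ.* 2 ℕ.^ u      ≡⟨ ℕ.^-distribˡ-+-* 2 u u ⟨
      2 ℕ.^ (u ℕ.+ u)          ≡⟨ cong (λ w → 2 ℕ.^ (u ℕ.+ w)) (ℕ.+-identityʳ u) ⟨
      2 ℕ.^ (2 ℕ.* u)          ≡⟨ j≡ ⟨
      j                        ∎
    2≤j : 2 ℕ.≤ j
    2≤j = ℕ.≤-trans (ℕ.≤-trans (ℕ.s≤s 0<u) (ℕ.m≤m*n (suc u) (suc u))) [1+u]²≤j
    2[2+j]≤ : 2 ℕ.* (2 ℕ.+ j) ℕ.≤ 2 ℕ.^ (2 ℕ.* suc u)
    2[2+j]≤ = begin
      2 ℕ.* (2 ℕ.+ j)          ≤⟨ ℕ.*-monoʳ-≤ 2 (ℕ.+-monoˡ-≤ j 2≤j) ⟩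
      2 ℕ.* (j ℕ.+ j)          ≡⟨ cong (λ w → 2 ℕ.* (j ℕ.+ w)) (ℕ.+-identityʳ j) ⟨
      2 ℕ.* (2 ℕ.* j)          ≡⟨ cong (λ w → 2 ℕ.* (2 ℕ.* w)) j≡ ⟩
      2 ℕ.^ (2 ℕ.+ 2 ℕ.* u)    ≡⟨ cong (2 ℕ.^_) (ℕ.*-suc 2 u) ⟨
      2 ℕ.^ (2 ℕ.* suc u)      ∎
    exponent : A ℕ.+ 2 ℕ.* suc u ℕ.* k ℕ.≤ j
    exponent = begin
      A ℕ.+ 2 ℕ.* suc u ℕ.* k             ≤⟨ ℕ.+-monoˡ-≤ (2 ℕ.* suc u ℕ.* k) (ℕ.m≤m*n A (suc u)) ⟩
      A ℕ.* suc u ℕ.+ 2 ℕ.* suc u ℕ.* k   ≡⟨ factor A (suc u) k ⟩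
      (A ℕ.+ 2 ℕ.* k) ℕ.* suc u           ≤⟨ ℕ.*-monoˡ-≤ (suc u) (ℕ.m≤n⇒m≤1+n A+2k≤u) ⟩
      suc u ℕ.* suc u                     ≤⟨ [1+u]²≤j ⟩
      j                                   ∎
      where
      factor : ∀ A v k → A ℕ.* v ℕ.+ 2 ℕ.* v ℕ.* k ≡ (A ℕ.+ 2 ℕ.* k) ℕ.* v
      factor = solve-∀

  exponential-dominates : ∀ A k J → ∃[ j ] J ℕ.≤ j × 1 ℕ.≤ j × A ℕ.* (2 ℕ.* (2 ℕ.+ j)) ℕ.^ k ℕ.≤ 2 ℕ.^ j
  -- u = A + 2k + J + 1 is positive and at least both A + 2k and J.
  exponential-dominates A k J = go (suc (A ℕ.+ 2 ℕ.* k ℕ.+ J)) (ℕ.s≤s ℕ.z≤n)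
      (ℕ.m≤n⇒m≤1+n (ℕ.m≤m+n (A ℕ.+ 2 ℕ.* k) J)) (ℕ.m≤n⇒m≤1+n (ℕ.m≤n+m J (A ℕ.+ 2 ℕ.* k)))
    where
    go : ∀ u → 0 ℕ.< u → A ℕ.+ 2 ℕ.* k ℕ.≤ u → J ℕ.≤ u →
         ∃[ j ] J ℕ.≤ j × 1 ℕ.≤ j × A ℕ.* (2 ℕ.* (2 ℕ.+ j)) ℕ.^ k ℕ.≤ 2 ℕ.^ j
    go u 0<u A+2k≤u J≤u = 2 ℕ.^ (2 ℕ.* u)
      , ℕ.≤-trans J≤u (ℕ.≤-trans (ℕ.m≤n*m u 2) (ℕ.<⇒≤ (n<2^n (2 ℕ.* u))))
      , ℕ.m^n>0 2 (2 ℕ.* u) , exponential-dominates-at A k u 0<u A+2k≤u refl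

  -- The main term along powers of 2.

  2^-point : ∀ j → 1 ℕ.≤ j → Point
  2^-point j 1≤j = record
    { value           = fromℕ (2 ℕ.^ j)
    ; 1<value         = 1ℚ , 0<1 , 0 , λ _ _ → fromℕℚ-mono-≤ (ℕ.^-monoʳ-≤ 2 1≤j)
    -- At a natural number the integer part is known outright, so the point can be constructed.
    ; ⌊value⌋         = 2 ℕ.^ j
    ; ⌊value⌋≤value   = λ ε 0<ε → 0 , λ _ _ → subst (_≤ fromℕℚ (2 ℕ.^ j) + ε) (ℚ.+-identityʳ (fromℕℚ (2 ℕ.^ j))) (ℚ.+-monoʳ-≤ (fromℕℚ (2 ℕ.^ j)) (ℚ.<⇒≤ 0<ε))
    ; value<⌊value⌋+1 = 1ℚ , 0<1 , 0 , λ _ _ → ℚ.≤-reflexive (trans (ℚ.+-comm (fromℕℚ (2 ℕ.^ j)) 1ℚ) (sym (fromℕℚ-suc (2 ℕ.^ j))))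
    }

  -- A Cauchy sequence is eventually bounded and ℚ is Archimedean. This moves a sample point past
  -- the threshold of an asymptotic relation.
  ≤fromℕ : ∀ X → ∃[ J ] ∀ n → J ℕ.≤ n → X D.≤ fromℕ n
  ≤fromℕ X = go (Cauchy-Lemmas.bounded (cauchy X))
    where
    open ℚ.≤-Reasoning
    go : (∃[ B ] 0ℚ < B × ∃[ N ] ∀ i → N ℕ.≤ i → ∣ seq X i ∣ ≤ B) → ∃[ J ] ∀ n → J ℕ.≤ n → X D.≤ fromℕ n
    go (B , _ , N , ∣X∣≤B) = proj₁ (archimedean B) , λ n J≤n ε 0<ε → N , λ i N≤i → begin
      seq X i           ≤⟨ p≤∣p∣ (seq X i) ⟩
      ∣ seq X i ∣       ≤⟨ ∣X∣≤B i N≤i ⟩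
      B                 ≤⟨ proj₂ (archimedean B) ⟩
      fromℕℚ (proj₁ (archimedean B)) ≤⟨ fromℕℚ-mono-≤ J≤n ⟩
      fromℕℚ n          ≡⟨ ℚ.+-identityʳ (fromℕℚ n) ⟨
      fromℕℚ n + 0ℚ     ≤⟨ ℚ.+-monoʳ-≤ (fromℕℚ n) (ℚ.<⇒≤ 0<ε) ⟩
      fromℕℚ n + ε      ∎

  seq-^ : ∀ x k n → seq (x D.^ k) n ≡ seq x n ^ℚ k
  seq-^ x zero    n = refl
  seq-^ x (suc k) n = cong (seq x n *_) (seq-^ x k n)

  -- With δ ≤ c eventually and log (2ʲ) ≤ 2j + 4, the main term is at least δ 2ʲ / (2j + 4)ᵏ. This
  -- is at least A once 2ʲ ≥ A E (2j + 4)ᵏ for some E ≥ 1/δ.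
  mainTerm-2^ : ∀ c → 0ℝ D.< c → ∀ k (A J : ℕ) → ∃[ j ] J ℕ.≤ j × ∃[ 1≤j ] ∃[ N ]
                ∀ n → N ℕ.≤ n → fromℕℚ A ≤ seq (mainTerm c k (2^-point j 1≤j)) n
  mainTerm-2^ c 0<c k A J = go (bounded-below {c} 0<c)
    where
    open ℚ.≤-Reasoning
    a = fromℕℚ A
    Goal = ∃[ j ] J ℕ.≤ j × ∃[ 1≤j ] ∃[ N ] ∀ n → N ℕ.≤ n → a ≤ seq (mainTerm c k (2^-point j 1≤j)) n

    module _ (δ : ℚ) (0<δ : 0ℚ < δ) (N : ℕ) (δ≤c : ∀ n → N ℕ.≤ n → δ ≤ seq c n)
             (E : ℕ) (1/δ≤E : recip δ ≤ fromℕℚ E)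
             (j : ℕ) (1≤j : 1 ℕ.≤ j) (big : A ℕ.* E ℕ.* (2 ℕ.* (2 ℕ.+ j)) ℕ.^ k ℕ.≤ 2 ℕ.^ j) where
      open Point (2^-point j 1≤j) using (1<value) renaming (value to x; 0<value to 0<x)
      K = 2 ℕ.^ j
      l = 2 ℕ.* (2 ℕ.+ j)
      w = fromℕℚ (l ℕ.^ k)

      numerator : ∀ n z → z ≤ w → δ ≤ seq c n → a * z ≤ seq c n * fromℕℚ K
      numerator n z z≤w δ≤cₙ = begin
        a * z                                   ≤⟨ *-monoˡ a (0≤fromℕℚ A) z≤w ⟩
        a * w                                   ≡⟨ ℚ.*-identityˡ (a * w) ⟨
        1ℚ * (a * w)                            ≡⟨ cong (_* (a * w)) (recip-inverse 0<δ) ⟨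
        δ * recip δ * (a * w)                   ≤⟨ *-monoʳ (a * w) (0≤* (0≤fromℕℚ A) (0≤fromℕℚ (l ℕ.^ k))) (*-monoˡ δ (ℚ.<⇒≤ 0<δ) 1/δ≤E) ⟩
        δ * fromℕℚ E * (a * w)                  ≡⟨ solve 4 (λ δ e a w → δ :* e :* (a :* w) := δ :* (a :* e :* w)) refl δ (fromℕℚ E) a w ⟩
        δ * (a * fromℕℚ E * w)                  ≡⟨ cong (λ e → δ * (e * w)) (fromℕℚ-* A E) ⟨
        δ * (fromℕℚ (A ℕ.* E) * w)              ≡⟨ cong (δ *_) (fromℕℚ-* (A ℕ.* E) (l ℕ.^ k)) ⟨
        δ * fromℕℚ (A ℕ.* E ℕ.* l ℕ.^ k)        ≤⟨ *-mono (0≤fromℕℚ (A ℕ.* E ℕ.* l ℕ.^ k)) (ℚ.≤-trans (ℚ.<⇒≤ 0<δ) δ≤cₙ) δ≤cₙ (fromℕℚ-mono-≤ big) ⟩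
        seq c n * fromℕℚ K                      ∎

      quotient : ∀ n L → 0ℚ < L → L ≤ fromℕℚ l → δ ≤ seq c n → a ≤ seq c n * fromℕℚ K * recip (L ^ℚ k)
      quotient n L 0<L L≤l δ≤cₙ = begin
        a                                        ≡⟨ ℚ.*-identityʳ a ⟨
        a * 1ℚ                                   ≡⟨ cong (a *_) (recip-inverse 0<L^k) ⟨
        a * (L ^ℚ k * recip (L ^ℚ k))            ≡⟨ ℚ.*-assoc a (L ^ℚ k) (recip (L ^ℚ k)) ⟨
        a * L ^ℚ k * recip (L ^ℚ k)              ≤⟨ *-monoʳ (recip (L ^ℚ k)) (ℚ.<⇒≤ (0<recip 0<L^k)) (numerator n (L ^ℚ k) L^k≤w δ≤cₙ) ⟩
        seq c n * fromℕℚ K * recip (L ^ℚ k)      ∎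
        where
        0<L^k = 0<^ k 0<L
        L^k≤w : L ^ℚ k ≤ w
        L^k≤w = subst (L ^ℚ k ≤_) (sym (fromℕℚ-^ l k)) (^-mono-≤ k (ℚ.<⇒≤ 0<L) L≤l)

      eventually : (∃[ ρ ] 0ℚ < ρ × ∃[ M ] ∀ n → M ℕ.≤ n → ρ ≤ seq (log x 0<x) n) →
                   ∃[ N′ ] ∀ n → N′ ℕ.≤ n → a ≤ seq (mainTerm c k (2^-point j 1≤j)) n
      -- From `N` on, δ ≤ c holds; from `M` on, the approximations of the logarithm are positive, so
      -- `recip` is a true inverse and not its junk value; from `K` on, the upper bound for the
      -- logarithm applies.
      eventually (ρ , 0<ρ , M , ρ≤log) = N ℕ.⊔ (M ℕ.⊔ K) , λ n p →
        let N≤n = ℕ.m⊔n≤o⇒m≤o N (M ℕ.⊔ K) p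
            q   = ℕ.m⊔n≤o⇒n≤o N (M ℕ.⊔ K) p
            M≤n = ℕ.m⊔n≤o⇒m≤o M K q
            K≤n = ℕ.m⊔n≤o⇒n≤o M K q
        in subst (λ z → a ≤ seq c n * fromℕℚ K * recip z) (sym (seq-^ (log x 0<x) k n))
             (quotient n (seq (log x 0<x) n) (ℚ.<-≤-trans 0<ρ (ρ≤log n M≤n)) (logSum-2^ j n K≤n) (δ≤c n N≤n))

      conclusion : J ℕ.≤ j → Goal
      conclusion J≤j = j , J≤j , 1≤j , eventually (bounded-below {log x 0<x} (log-pos {x} 0<x 1<value))

    go : (∃[ δ ] 0ℚ < δ × ∃[ N ] ∀ n → N ℕ.≤ n → δ ≤ seq c n) → Goal
    go (δ , 0<δ , N , δ≤c) = choose (exponential-dominates (A ℕ.* E) k J)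
      where
      E = proj₁ (archimedean (recip δ))
      choose : (∃[ j ] J ℕ.≤ j × 1 ℕ.≤ j × A ℕ.* E ℕ.* (2 ℕ.* (2 ℕ.+ j)) ℕ.^ k ℕ.≤ 2 ℕ.^ j) → Goal
      choose (j , J≤j , 1≤j , big) = conclusion δ 0<δ N δ≤c E (proj₂ (archimedean (recip δ))) j 1≤j big J≤j

  -- From the asymptotic formula to unboundedness.

  approximation-lower-bound : ∀ m F g → (1ℚ + 1ℚ) * (1ℚ + (1ℚ + m)) ≤ g → 0ℚ ≤ g → ∣ F - g ∣ ≤ ℚ.½ * ∣ g ∣ + 1ℚ → 1ℚ + m ≤ F
  approximation-lower-bound m F g A≤g 0≤g close = begin
    1ℚ + m                          ≡⟨ solve 1 (λ m → con 1ℚ :+ m := con ℚ.½ :* ((con 1ℚ :+ con 1ℚ) :* (con 1ℚ :+ (con 1ℚ :+ m))) :- con 1ℚ) refl m ⟩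
    ℚ.½ * ((1ℚ + 1ℚ) * (1ℚ + (1ℚ + m))) - 1ℚ
                                    ≤⟨ ℚ.+-monoˡ-≤ (- 1ℚ) (*-monoˡ ℚ.½ (ℚ.<⇒≤ 0<½) A≤g) ⟩
    ℚ.½ * g - 1ℚ                    ≡⟨ solve 2 (λ g F → con ℚ.½ :* g :- con 1ℚ := (g :- F) :+ (F :- con ℚ.½ :* g :- con 1ℚ)) refl g F ⟩
    (g - F) + (F - ℚ.½ * g - 1ℚ)    ≤⟨ ℚ.+-monoˡ-≤ (F - ℚ.½ * g - 1ℚ) g-F≤ ⟩
    (ℚ.½ * g + 1ℚ) + (F - ℚ.½ * g - 1ℚ)
                                    ≡⟨ solve 2 (λ g F → (con ℚ.½ :* g :+ con 1ℚ) :+ (F :- con ℚ.½ :* g :- con 1ℚ) := F) refl g F ⟩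
    F                               ∎
    where
    open ℚ.≤-Reasoning
    g-F≤ : g - F ≤ ℚ.½ * g + 1ℚ
    g-F≤ = begin
      g - F                 ≤⟨ p≤∣p∣ (g - F) ⟩
      ∣ g - F ∣             ≡⟨ ∣-∣-swap g F ⟩
      ∣ F - g ∣             ≤⟨ close ⟩
      ℚ.½ * ∣ g ∣ + 1ℚ      ≡⟨ cong (λ z → ℚ.½ * z + 1ℚ) (ℚ.0≤p⇒∣p∣≡p 0≤g) ⟩
      ℚ.½ * g + 1ℚ          ∎

  ∼mainTerm⇒unbounded : ∀ (f : ℕ → ℕ) c k → 0ℝ D.< c → (λ t → fromℕ (f (Point.⌊value⌋ t))) ∼ mainTerm c k →
                        ∀ M → ∃[ n ] M ℕ.< f n
  ∼mainTerm⇒unbounded f c k 0<c f∼ M = choose (mainTerm-2^ c 0<c k A (proj₁ (≤fromℕ X)))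
    where
    -- The relative error ½ halves the main term and an additive tolerance takes another 1, leaving
    -- A/2 - 1 = M + 1.
    A = 2 ℕ.* (2 ℕ.+ M)
    m = fromℕℚ M
    X = proj₁ (f∼ ℚ.½ 0<½)

    A≡ : fromℕℚ A ≡ (1ℚ + 1ℚ) * (1ℚ + (1ℚ + m))
    A≡ = trans (fromℕℚ-* 2 (2 ℕ.+ M)) (cong (fromℕℚ 2 *_) (trans (fromℕℚ-suc (suc M)) (cong (1ℚ +_) (fromℕℚ-suc M))))

    f-large : ∀ t → X D.≤ Point.value t → (∃[ N ] ∀ n → N ℕ.≤ n → fromℕℚ A ≤ seq (mainTerm c k t) n) →
              M ℕ.< f (Point.⌊value⌋ t)
    -- The order on ℝ carries a tolerance of its own, here taken to be 1. A single late rational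
    -- approximation then decides the inequality between natural numbers.
    f-large t X≤t (N , A≤main) = at (proj₂ (f∼ ℚ.½ 0<½) t X≤t 1ℚ 0<1)
      where
      at : (∃[ N ] ∀ n → N ℕ.≤ n → ∣ fromℕℚ (f (Point.⌊value⌋ t)) - seq (mainTerm c k t) n ∣ ≤ ℚ.½ * ∣ seq (mainTerm c k t) n ∣ + 1ℚ) →
           M ℕ.< f (Point.⌊value⌋ t)
      at (N′ , close) = fromℕℚ-cancel-≤ (subst (_≤ fromℕℚ (f (Point.⌊value⌋ t))) (sym (fromℕℚ-suc M))
        (approximation-lower-bound m (fromℕℚ (f (Point.⌊value⌋ t))) (seq (mainTerm c k t) (N ℕ.⊔ N′)) (subst (_≤ seq (mainTerm c k t) (N ℕ.⊔ N′)) A≡ A≤g)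
          (ℚ.≤-trans (0≤fromℕℚ A) A≤g) (close (N ℕ.⊔ N′) (ℕ.m≤n⊔m N N′))))
        where
        A≤g = A≤main (N ℕ.⊔ N′) (ℕ.m≤m⊔n N N′)

    choose : (∃[ j ] proj₁ (≤fromℕ X) ℕ.≤ j × ∃[ 1≤j ] ∃[ N ]
                ∀ n → N ℕ.≤ n → fromℕℚ A ≤ seq (mainTerm c k (2^-point j 1≤j)) n) → ∃[ n ] M ℕ.< f n
    choose (j , J≤j , 1≤j , A≤main) = 2 ℕ.^ j ,
      f-large (2^-point j 1≤j) (proj₂ (≤fromℕ X) (2 ℕ.^ j) (ℕ.≤-trans J≤j (ℕ.<⇒≤ (n<2^n j)))) A≤main

open import Data.Bool.Base using (T)
open import Data.Digit using (Expansion; fromDigits; toDigits)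
open import Data.Fin.Base using (Fin; toℕ; fromℕ<)
open import Data.Fin.Patterns using (0F; 1F; 2F)
import Data.Fin.Properties as Fin
open import Data.Integer.Base as ℤ using (ℤ)
import Data.Integer.Divisibility as ℤ
open import Data.List.Base using (List; []; _∷_; _++_; map; filter; length; upTo; [_])
open import Data.List.Extrema.Nat using (max≤v⁺; v≤max⁺)
open import Data.List.Membership.Propositional using (_∈_)
open import Data.List.Membership.Propositional.Properties using (∈-filter⁺; ∈-filter⁻; ∈-upTo⁺)
open import Data.List.Membership.Propositional.Properties.WithK using (unique∧set⇒bag)
import Data.List.Properties as List
open import Data.List.Relation.Binary.BagAndSetEquality using (∼bag⇒↭)
open import Data.List.Relation.Binary.Permutation.Propositional using (_↭_; ↭-sym)
open import Data.List.Relation.Binary.Permutation.Propositional.Properties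
  using (↭-length; All-resp-↭; Any-resp-↭) renaming (map⁺ to ↭-map⁺)
open import Data.List.Relation.Unary.All using (All; []; _∷_)
import Data.List.Relation.Unary.AllPairs as AllPairs
open import Data.List.Relation.Unary.Any using (here; there)
import Data.List.Relation.Unary.Unique.Propositional.Properties as Unique
open import Data.Nat.Base
open import Data.Nat.Divisibility
open import Data.Nat.DivMod using (m*n/n≡m; [m+kn]%n≡m%n; m<n⇒m%n≡m)
open import Data.Nat.GCD using (gcd; gcd-greatest)
open import Data.Nat.ListAction using (sum; product)
open import Data.Nat.Primality
open import Data.Nat.Primality.Factorisation using (factorise)
open import Data.Nat.Properties
open import Data.Nat.Tactic.RingSolver using (solve-∀)
open import Data.Product.Base using (∃-syntax; _×_; _,_; proj₁; proj₂)
open import Data.Sum.Base using (_⊎_; inj₁; inj₂)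
open import Function.Base using (_∘_)
open import Function.Bundles using (mk⇔)
open import Relation.Binary.PropositionalEquality
  using (_≡_; _≢_; refl; sym; trans; cong; cong₂; subst; module ≡-Reasoning)
open import Relation.Nullary using (¬_; yes; no; contradiction; _×-dec_)
open import Relation.Unary using (Decidable)
open import Defs using
  (PrimeKTuplesConjecture; LucasCarmichael; degree; primeDivisors; digitSum;
   Primeℤ; primeℤ?; linearForm; formProduct; primeTupleCount)

-- Large prime tuples from the counting function.

length-filter>⇒∃ : ∀ {p} {P : ℕ → Set p} (P? : Decidable P) n M →
                   M < length (filter P? (map suc (upTo n))) → ∃[ m ] M < m × P m
length-filter>⇒∃ P? (suc n) M M< with P? (suc n)
-- Scanning from the top, the first hit `suc n` is at least the number of hits, which exceeds `M`.
... | yes Pn = suc n , ≤-trans M< (≤-trans (List.length-filter P? (map suc (upTo (suc n))))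
        (≤-reflexive (trans (List.length-map suc (upTo (suc n))) (List.length-upTo (suc n))))) , Pn
... | no ¬Pn = length-filter>⇒∃ P? n M (subst (λ xs → M < length xs) (begin
  filter P? (map suc (upTo (suc n)))                  ≡⟨ cong (filter P? ∘ map suc) (List.upTo-∷ʳ n) ⟨
  filter P? (map suc (upTo n ++ [ n ]))               ≡⟨ cong (filter P?) (List.map-++ suc (upTo n) [ n ]) ⟩
  filter P? (map suc (upTo n) ++ [ suc n ])           ≡⟨ List.filter-++ P? (map suc (upTo n)) [ suc n ] ⟩
  filter P? (map suc (upTo n)) ++ filter P? [ suc n ] ≡⟨ cong (filter P? (map suc (upTo n)) ++_) (List.filter-reject P? ¬Pn) ⟩
  filter P? (map suc (upTo n)) ++ []                  ≡⟨ List.++-identityʳ _ ⟩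
  filter P? (map suc (upTo n))                        ∎) M<)
  where open ≡-Reasoning

-- The count is unbounded because its main term is, and more than `M` positive integers cannot all
-- be at most `M`.
largePrimeTuples : PrimeKTuplesConjecture → ∀ {k} .{{_ : NonZero k}} (a : Fin k → ℕ) (b : Fin k → ℤ) →
  (∀ i → 0 < a i) → (∀ i → b i ≢ ℤ.+ 0) → (∀ i j → a i ≡ a j → b i ≡ b j → i ≡ j) →
  ¬ (∃[ p ] Prime p × ∀ m → 1 ≤ m → ℤ.+ p ℤ.∣ formProduct a b m) →
  ∀ M → ∃[ m ] M < m × ∀ i → Primeℤ (linearForm a b i m)
largePrimeTuples conjecture {k} a b 0<a b≢0 distinct admissible M = go (conjecture k a b 0<a b≢0 distinct admissible)
  where
  go : _ → ∃[ m ] M < m × ∀ i → Primeℤ (linearForm a b i m)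
  go (c , 0<c , count∼) = many (Analysis.∼mainTerm⇒unbounded (primeTupleCount a b) c k 0<c count∼ M)
    where
    many : ∃[ n ] M < primeTupleCount a b n → ∃[ m ] M < m × ∀ i → Primeℤ (linearForm a b i m)
    many (n , M<count) = length-filter>⇒∃ (λ m → Fin.all? λ i → primeℤ? (linearForm a b i m)) n M M<count

-- Digit expansions and digit sums.

fromDigits-%-/ : ∀ {b} {{_ : NonZero b}} (d : Fin b) n {e : Fin b} {m} →
                 toℕ d + n * b ≡ toℕ e + m * b → toℕ d ≡ toℕ e × n ≡ m
fromDigits-%-/ {b} d n {e} {m} eq = d≡e , *-cancelʳ-≡ n m b (+-cancelˡ-≡ (toℕ d) (n * b) (m * b)
    (trans eq (cong (_+ m * b) (sym d≡e))))
  where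
  open ≡-Reasoning
  d≡e : toℕ d ≡ toℕ e
  d≡e = begin
    toℕ d                    ≡⟨ m<n⇒m%n≡m (Fin.toℕ<n d) ⟨
    toℕ d % b                ≡⟨ [m+kn]%n≡m%n (toℕ d) n b ⟨
    (toℕ d + n * b) % b      ≡⟨ cong (_% b) eq ⟩
    (toℕ e + m * b) % b      ≡⟨ [m+kn]%n≡m%n (toℕ e) m b ⟩
    toℕ e % b                ≡⟨ m<n⇒m%n≡m (Fin.toℕ<n e) ⟩
    toℕ e                    ∎

sumDigits : ∀ {b} → Expansion b → ℕ
sumDigits ds = sum (map toℕ ds)

fromDigits≡0⇒sum≡0 : ∀ {b} {{_ : NonZero b}} (ds : Expansion b) → fromDigits ds ≡ 0 → sumDigits ds ≡ 0
fromDigits≡0⇒sum≡0 [] _ = refl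
fromDigits≡0⇒sum≡0 {b} (d ∷ ds) eq = cong₂ _+_ (m+n≡0⇒m≡0 (toℕ d) eq)
  (fromDigits≡0⇒sum≡0 ds (m*n≡0⇒m≡0 (fromDigits ds) b (m+n≡0⇒n≡0 (toℕ d) eq)))

-- Expansions of the same number may differ by zeros at the most significant end, so the lists need
-- not agree, but their sums do.
fromDigits≡⇒sum≡ : ∀ {b} {{_ : NonZero b}} (ds es : Expansion b) → fromDigits ds ≡ fromDigits es →
                   sumDigits ds ≡ sumDigits es
fromDigits≡⇒sum≡ []       es       eq = sym (fromDigits≡0⇒sum≡0 es (sym eq))
fromDigits≡⇒sum≡ (d ∷ ds) []       eq = fromDigits≡0⇒sum≡0 (d ∷ ds) eq
fromDigits≡⇒sum≡ (d ∷ ds) (e ∷ es) eq with fromDigits-%-/ d (fromDigits ds) {e} {fromDigits es} eq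
... | d≡e , ds≡es = cong₂ _+_ d≡e (fromDigits≡⇒sum≡ ds es ds≡es)

-- Any exhibited expansion may thus replace the output of `toDigits`.
digitSum-fromDigits : ∀ p {N} (ds : Expansion (2 + p)) → N ≡ fromDigits ds → digitSum (2 + p) N ≡ sumDigits ds
digitSum-fromDigits p {N} ds eq = fromDigits≡⇒sum≡ (proj₁ (toDigits (2 + p) N)) ds (trans (proj₂ (toDigits (2 + p) N)) eq)

-- Products of three distinct primes.

prime∣prime⇒≡ : ∀ {p q} → Prime p → Prime q → p ∣ q → p ≡ q
prime∣prime⇒≡ pp pq p∣q with prime⇒irreducible pq p∣q
... | inj₁ refl = contradiction pp ¬prime[1]
... | inj₂ p≡q  = p≡q

∃-prime-divisor : ∀ n .{{_ : NonZero n}} → n ≢ 1 → ∃[ p ] Prime p × p ∣ n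
∃-prime-divisor n n≢1 with factorise n
... | record { factors = []     ; isFactorisation = eq } = contradiction eq n≢1
... | record { factors = p ∷ ps ; isFactorisation = eq ; factorsPrime = pp ∷ _ } =
  p , pp , subst (p ∣_) (sym eq) (m∣m*n (product ps))

-- The function that `degree` maximises over the prime divisors.
digitQuotient : ℕ → ℕ → ℕ
digitQuotient n p = (digitSum (2 + p) (n + 2) ∸ 1) / suc p

module _ {p q r : ℕ} (pp : Prime p) (pq : Prime q) (pr : Prime r) where

  prime∣pqr⇒≡ : ∀ {s} → Prime s → s ∣ p * q * r → s ≡ p ⊎ s ≡ q ⊎ s ≡ r
  prime∣pqr⇒≡ ps s∣ with euclidsLemma (p * q) r ps s∣
  ... | inj₂ s∣r = inj₂ (inj₂ (prime∣prime⇒≡ ps pr s∣r))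
  ... | inj₁ s∣pq with euclidsLemma p q ps s∣pq
  ...   | inj₁ s∣p = inj₁ (prime∣prime⇒≡ ps pp s∣p)
  ...   | inj₂ s∣q = inj₂ (inj₁ (prime∣prime⇒≡ ps pq s∣q))

  p∣pqr : p ∣ p * q * r
  p∣pqr = ∣-trans (m∣m*n q) (m∣m*n r)

  q∣pqr : q ∣ p * q * r
  q∣pqr = ∣-trans (n∣m*n p) (m∣m*n r)

  r∣pqr : r ∣ p * q * r
  r∣pqr = n∣m*n (p * q)

  instance
    nonZero-pqr : NonZero (p * q * r)
    nonZero-pqr = m*n≢0 (p * q) r {{m*n≢0 p q {{prime⇒nonZero pp}} {{prime⇒nonZero pq}}}} {{prime⇒nonZero pr}}

  module _ (p<q : p < q) (q<r : q < r) where

    private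
      p<r = <-trans p<q q<r

    -- `s` is one of the three primes. After cancelling it once, it still divides the product of the
    -- other two, hence equals one of them.
    square∤pqr : ∀ {s} → Prime s → ¬ (s * s ∣ p * q * r)
    square∤pqr {s} ps ss∣ with prime∣pqr⇒≡ ps (∣-trans (m∣m*n s) ss∣)
    ... | inj₁ refl with euclidsLemma q r pp (*-cancelˡ-∣ p {{prime⇒nonZero pp}} (subst (p * p ∣_) (*-assoc p q r) ss∣))
    ...   | inj₁ p∣q = <⇒≢ p<q (prime∣prime⇒≡ pp pq p∣q)
    ...   | inj₂ p∣r = <⇒≢ p<r (prime∣prime⇒≡ pp pr p∣r)
    square∤pqr ps ss∣ | inj₂ (inj₁ refl)
      with euclidsLemma p r pq (*-cancelˡ-∣ q {{prime⇒nonZero pq}} (subst (q * q ∣_) (trans (cong (_* r) (*-comm p q)) (*-assoc q p r)) ss∣))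
    ...   | inj₁ q∣p = <⇒≢ p<q (sym (prime∣prime⇒≡ pq pp q∣p))
    ...   | inj₂ q∣r = <⇒≢ q<r (prime∣prime⇒≡ pq pr q∣r)
    square∤pqr ps ss∣ | inj₂ (inj₂ refl)
      with euclidsLemma p q pr (*-cancelʳ-∣ r {{prime⇒nonZero pr}} ss∣)
    ...   | inj₁ r∣p = <⇒≢ p<r (sym (prime∣prime⇒≡ pr pp r∣p))
    ...   | inj₂ r∣q = <⇒≢ q<r (sym (prime∣prime⇒≡ pr pq r∣q))

    squareFree-pqr : ∀ d → d * d ∣ p * q * r → d ≡ 1
    squareFree-pqr d dd∣ with d ≟ 1
    ... | yes d≡1 = d≡1
    -- d = 0 is excluded since pqr is nonzero. Otherwise a prime `s` divides `d`, and its square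
    -- would divide pqr.
    ... | no  d≢1 with ∃-prime-divisor d {{≢-nonZero λ { refl → ≢-nonZero⁻¹ (p * q * r) (0∣⇒≡0 dd∣) }}} d≢1
    ...   | s , ps , s∣d = contradiction (∣-trans (*-pres-∣ s∣d s∣d) dd∣) (square∤pqr ps)

    composite-pqr : Composite (p * q * r)
    composite-pqr = composite-≢ p {{prime⇒nonTrivial pp}}
      (λ p≡ → <⇒≢ p<q (sym (prime∣prime⇒≡ pq pp (subst (q ∣_) (sym p≡) q∣pqr)))) p∣pqr

    -- Two duplicate-free lists with the same members are permutations of each other, so the order
    -- produced by the filter need not be computed.
    primeDivisors-pqr : primeDivisors (p * q * r) ↭ p ∷ q ∷ r ∷ []
    primeDivisors-pqr = ∼bag⇒↭ (unique∧set⇒bag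
      (Unique.filter⁺ prime-divisor? (Unique.upTo⁺ (suc (p * q * r))))
      ((<⇒≢ p<q ∷ <⇒≢ p<r ∷ []) AllPairs.∷ (<⇒≢ q<r ∷ []) AllPairs.∷ [] AllPairs.∷ AllPairs.[])
      (mk⇔ to from))
      where
      prime-divisor? : Decidable (λ s → Prime s × s ∣ p * q * r)
      prime-divisor? s = prime? s ×-dec (s ∣? p * q * r)
      to : ∀ {s} → s ∈ primeDivisors (p * q * r) → s ∈ p ∷ q ∷ r ∷ []
      to s∈ with ∈-filter⁻ prime-divisor? {xs = upTo (suc (p * q * r))} s∈
      ... | _ , ps , s∣ with prime∣pqr⇒≡ ps s∣
      ...   | inj₁ s≡p        = here s≡p
      ...   | inj₂ (inj₁ s≡q) = there (here s≡q)
      ...   | inj₂ (inj₂ s≡r) = there (there (here s≡r))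
      divisor : ∀ {s} → Prime s → s ∣ p * q * r → s ∈ primeDivisors (p * q * r)
      divisor ps s∣ = ∈-filter⁺ prime-divisor? (∈-upTo⁺ (s≤s (∣⇒≤ s∣))) (ps , s∣)
      from : ∀ {s} → s ∈ p ∷ q ∷ r ∷ [] → s ∈ primeDivisors (p * q * r)
      from (here refl)                 = divisor pp p∣pqr
      from (there (here refl))         = divisor pq q∣pqr
      from (there (there (here refl))) = divisor pr r∣pqr

    lucasCarmichael-pqr : p + 1 ∣ p * q * r + 1 → q + 1 ∣ p * q * r + 1 → r + 1 ∣ p * q * r + 1 →
                          LucasCarmichael (p * q * r)
    lucasCarmichael-pqr p+1∣ q+1∣ r+1∣ = record
      { squareFree = squareFree-pqr
      ; composite  = composite-pqr
      ; p+1∣n+1    = s+1∣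
      }
      where
      s+1∣ : ∀ s → Prime s → s ∣ p * q * r → s + 1 ∣ p * q * r + 1
      s+1∣ s ps s∣ with prime∣pqr⇒≡ ps s∣
      ... | inj₁ refl        = p+1∣
      ... | inj₂ (inj₁ refl) = q+1∣
      ... | inj₂ (inj₂ refl) = r+1∣

    -- The maximum is attained at `p`; at the other two primes an upper bound suffices.
    degree-pqr : ∀ {α} → digitQuotient (p * q * r) p ≡ α → digitQuotient (p * q * r) q ≤ α →
                 digitQuotient (p * q * r) r ≤ α → degree (p * q * r) ≡ α
    degree-pqr p≡α q≤α r≤α = ≤-antisym
      (max≤v⁺ z≤n (All-resp-↭ quotients (≤-reflexive p≡α ∷ q≤α ∷ r≤α ∷ [])))
      (v≤max⁺ 0 _ (inj₂ (Any-resp-↭ quotients (here (≤-reflexive (sym p≡α))))))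
      where
      quotients : map (digitQuotient (p * q * r)) (p ∷ q ∷ r ∷ []) ↭ map (digitQuotient (p * q * r)) (primeDivisors (p * q * r))
      quotients = ↭-map⁺ (digitQuotient (p * q * r)) (↭-sym primeDivisors-pqr)

-- Explicit digit lists.

digitQuotient-fromDigits : ∀ {n p} (ds : Expansion (2 + p)) a → n + 2 ≡ fromDigits ds →
                           sumDigits ds ≡ suc (a * suc p) → digitQuotient n p ≡ a
digitQuotient-fromDigits {n} {p} ds a n+2≡ sum≡ = trans
  (cong (λ s → (s ∸ 1) / suc p) (trans (digitSum-fromDigits p ds n+2≡) sum≡)) (m*n/n≡m a (suc p))

-- Keeping plain numbers apart from their bounds turns the value and the sum of an expansion into
-- polynomial expressions, which a ring solver can treat.
digits : ∀ {b} (xs : List ℕ) → All (_< b) xs → Expansion b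
digits []       []        = []
digits (x ∷ xs) (px ∷ ps) = fromℕ< px ∷ digits xs ps

value : ℕ → List ℕ → ℕ
value b []       = 0
value b (x ∷ xs) = x + value b xs * b

fromDigits-digits : ∀ {b} xs (ps : All (_< b) xs) → fromDigits (digits xs ps) ≡ value b xs
fromDigits-digits []       []        = refl
fromDigits-digits {b} (x ∷ xs) (px ∷ ps) = cong₂ (λ y v → y + v * b) (Fin.toℕ-fromℕ< px) (fromDigits-digits xs ps)

sumDigits-digits : ∀ {b} xs (ps : All (_< b) xs) → sumDigits (digits xs ps) ≡ sum xs
sumDigits-digits []       []        = refl
sumDigits-digits (x ∷ xs) (px ∷ ps) = cong₂ _+_ (Fin.toℕ-fromℕ< px) (sumDigits-digits xs ps)

digitQuotient≡ : ∀ {n p} (xs : List ℕ) a → All (_< 2 + p) xs → n + 2 ≡ value (2 + p) xs →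
                 sum xs ≡ suc (a * suc p) → digitQuotient n p ≡ a
digitQuotient≡ {n} xs a ps n+2≡ sum≡ = digitQuotient-fromDigits {n} (digits xs ps) a
  (trans n+2≡ (sym (fromDigits-digits xs ps))) (trans (sumDigits-digits xs ps) sum≡)

-- The comparisons of coefficients are implicit arguments settled by evaluation, so at numerals only
-- the coefficients are written.
linear-< : ∀ a b c d {a<c : T (a <ᵇ c)} {b≤d : T (b ≤ᵇ d)} k → a + b * k < c + d * k
linear-< a b c d {a<c} {b≤d} k = +-mono-<-≤ (<ᵇ⇒< a c a<c) (*-monoˡ-≤ k (≤ᵇ⇒≤ b d b≤d))

-- The family of products, its expansions and divisibilities.

-- 6m - 1, 12m - 1 and 18m - 1 at m = 8 + k.
p₁ p₂ p₃ : ℕ → ℕ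
p₁ k = 47 + 6 * k
p₂ k = 95 + 12 * k
p₃ k = 143 + 18 * k

p₁p₂p₃ : ℕ → ℕ
p₁p₂p₃ k = p₁ k * p₂ k * p₃ k

-- Least significant digit first; every digit is written as a + b * k, so that linear-< bounds it.
digits-p₁ : ℕ → List ℕ
digits-p₁ k = 27 + 6 * k ∷ 45 + 0 * k ∷ 20 + 6 * k ∷ 5 + 0 * k ∷ []

-- The local restatement unfolds everything to a polynomial identity in `k` for the ring solver;
-- later identities follow the same pattern.
n+2-base-p₁+2 : ∀ k → p₁p₂p₃ k + 2 ≡ value (2 + p₁ k) (digits-p₁ k)
n+2-base-p₁+2 = expansion
  where
  expansion : ∀ k → (47 + 6 * k) * (95 + 12 * k) * (143 + 18 * k) + 2 ≡
    27 + 6 * k + (45 + 0 * k + (20 + 6 * k + (5 + 0 * k + 0 * (49 + 6 * k)) * (49 + 6 * k)) * (49 + 6 * k)) * (49 + 6 * k)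
  expansion = solve-∀

digits-p₂ : ℕ → List ℕ
digits-p₂ k = 43 + 6 * k ∷ 83 + 9 * k ∷ 67 + 9 * k ∷ []

n+2-base-p₂+2 : ∀ k → p₁p₂p₃ k + 2 ≡ value (2 + p₂ k) (digits-p₂ k)
n+2-base-p₂+2 = expansion
  where
  expansion : ∀ k → (47 + 6 * k) * (95 + 12 * k) * (143 + 18 * k) + 2 ≡
    43 + 6 * k + (83 + 9 * k + (67 + 9 * k + 0 * (97 + 12 * k)) * (97 + 12 * k)) * (97 + 12 * k)
  expansion = solve-∀

digits-p₃ : ℕ → List ℕ
digits-p₃ k = 62 + 8 * k ∷ 53 + 6 * k ∷ 30 + 4 * k ∷ []

n+2-base-p₃+2 : ∀ k → p₁p₂p₃ k + 2 ≡ value (2 + p₃ k) (digits-p₃ k)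
n+2-base-p₃+2 = expansion
  where
  expansion : ∀ k → (47 + 6 * k) * (95 + 12 * k) * (143 + 18 * k) + 2 ≡
    62 + 8 * k + (53 + 6 * k + (30 + 4 * k + 0 * (145 + 18 * k)) * (145 + 18 * k)) * (145 + 18 * k)
  expansion = solve-∀

digitQuotient-p₁ : ∀ k → digitQuotient (p₁p₂p₃ k) (p₁ k) ≡ 2
digitQuotient-p₁ k = digitQuotient≡ {p₁p₂p₃ k} {p₁ k} (digits-p₁ k) 2 bounds (n+2-base-p₁+2 k) (digit-sum k)
  where
  bounds : All (_< 2 + p₁ k) (digits-p₁ k)
  -- The digit 45 is the critical one: 45 < 6m + 1 holds exactly for m ≥ 8, whence the shift m = 8 +
  -- k.
  bounds = linear-< 27 6 49 6 k ∷ linear-< 45 0 49 6 k ∷ linear-< 20 6 49 6 k ∷ linear-< 5 0 49 6 k ∷ []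
  digit-sum : ∀ k → 27 + 6 * k + (45 + 0 * k + (20 + 6 * k + (5 + 0 * k + 0))) ≡ suc (2 * suc (47 + 6 * k))
  digit-sum = solve-∀

digitQuotient-p₂ : ∀ k → digitQuotient (p₁p₂p₃ k) (p₂ k) ≡ 2
digitQuotient-p₂ k = digitQuotient≡ {p₁p₂p₃ k} {p₂ k} (digits-p₂ k) 2 bounds (n+2-base-p₂+2 k) (digit-sum k)
  where
  bounds : All (_< 2 + p₂ k) (digits-p₂ k)
  bounds = linear-< 43 6 97 12 k ∷ linear-< 83 9 97 12 k ∷ linear-< 67 9 97 12 k ∷ []
  digit-sum : ∀ k → 43 + 6 * k + (83 + 9 * k + (67 + 9 * k + 0)) ≡ suc (2 * suc (95 + 12 * k))
  digit-sum = solve-∀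

digitQuotient-p₃ : ∀ k → digitQuotient (p₁p₂p₃ k) (p₃ k) ≡ 1
digitQuotient-p₃ k = digitQuotient≡ {p₁p₂p₃ k} {p₃ k} (digits-p₃ k) 1 bounds (n+2-base-p₃+2 k) (digit-sum k)
  where
  bounds : All (_< 2 + p₃ k) (digits-p₃ k)
  bounds = linear-< 62 8 145 18 k ∷ linear-< 53 6 145 18 k ∷ linear-< 30 4 145 18 k ∷ []
  digit-sum : ∀ k → 62 + 8 * k + (53 + 6 * k + (30 + 4 * k + 0)) ≡ suc (1 * suc (143 + 18 * k))
  digit-sum = solve-∀

-- Here 277 + 36k is 36m - 11 at m = 8 + k, which keeps the factorisation free of subtraction.
n+1≡ : ∀ k → p₁p₂p₃ k + 1 ≡ ((8 + k) * (277 + 36 * k) + 1) * (36 * (8 + k))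
n+1≡ = factorisation
  where
  factorisation : ∀ k → (47 + 6 * k) * (95 + 12 * k) * (143 + 18 * k) + 1 ≡ ((8 + k) * (277 + 36 * k) + 1) * (36 * (8 + k))
  factorisation = solve-∀

-- It is applied with d = 6, 12 and 18, since the three primes plus one are 6m, 12m and 18m.
∣36⇒∣n+1 : ∀ d k → d ∣ 36 → d * (8 + k) ∣ p₁p₂p₃ k + 1
∣36⇒∣n+1 d k d∣36 = subst (d * (8 + k) ∣_) (sym (n+1≡ k))
  (∣-trans (*-monoˡ-∣ (8 + k) d∣36) (n∣m*n ((8 + k) * (277 + 36 * k) + 1)))

p₁+1∣n+1 : ∀ k → p₁ k + 1 ∣ p₁p₂p₃ k + 1
p₁+1∣n+1 k = subst (_∣ p₁p₂p₃ k + 1) (p₁+1≡ k) (∣36⇒∣n+1 6 k (divides 6 refl))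
  where
  p₁+1≡ : ∀ k → 6 * (8 + k) ≡ 47 + 6 * k + 1
  p₁+1≡ = solve-∀

p₂+1∣n+1 : ∀ k → p₂ k + 1 ∣ p₁p₂p₃ k + 1
p₂+1∣n+1 k = subst (_∣ p₁p₂p₃ k + 1) (p₂+1≡ k) (∣36⇒∣n+1 12 k (divides 3 refl))
  where
  p₂+1≡ : ∀ k → 12 * (8 + k) ≡ 95 + 12 * k + 1
  p₂+1≡ = solve-∀

p₃+1∣n+1 : ∀ k → p₃ k + 1 ∣ p₁p₂p₃ k + 1
p₃+1∣n+1 k = subst (_∣ p₁p₂p₃ k + 1) (p₃+1≡ k) (∣36⇒∣n+1 18 k (divides 2 refl))
  where
  p₃+1≡ : ∀ k → 18 * (8 + k) ≡ 143 + 18 * k + 1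
  p₃+1≡ = solve-∀

module _ (k : ℕ) (pp : Prime (p₁ k)) (pq : Prime (p₂ k)) (pr : Prime (p₃ k)) where

  private
    p₁<p₂ : p₁ k < p₂ k
    p₁<p₂ = linear-< 47 6 95 12 k

    p₂<p₃ : p₂ k < p₃ k
    p₂<p₃ = linear-< 95 12 143 18 k

  lucasCarmichael-p₁p₂p₃ : LucasCarmichael (p₁p₂p₃ k)
  lucasCarmichael-p₁p₂p₃ =
    lucasCarmichael-pqr pp pq pr p₁<p₂ p₂<p₃ (p₁+1∣n+1 k) (p₂+1∣n+1 k) (p₃+1∣n+1 k)

  degree-p₁p₂p₃ : degree (p₁p₂p₃ k) ≡ 2
  degree-p₁p₂p₃ = degree-pqr pp pq pr p₁<p₂ p₂<p₃ (digitQuotient-p₁ k)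
    (≤-reflexive (digitQuotient-p₂ k)) (≤-trans (≤-reflexive (digitQuotient-p₃ k)) (n≤1+n 1))

  length-primeDivisors-p₁p₂p₃ : length (primeDivisors (p₁p₂p₃ k)) ≡ 3
  length-primeDivisors-p₁p₂p₃ = ↭-length (primeDivisors-pqr pp pq pr p₁<p₂ p₂<p₃)

-- The three linear forms and the conclusion.

coefficient : Fin 3 → ℕ
coefficient i = 6 * suc (toℕ i)

constant : Fin 3 → ℤ
constant _ = ℤ.-[1+ 0 ]

admissible : ¬ (∃[ p ] Prime p × ∀ m → 1 ≤ m → ℤ.+ p ℤ.∣ formProduct coefficient constant m)
-- The gcd of the two sample values evaluates to 1.
admissible (p , pp , p∣) = ¬prime[1] (subst Prime (∣1⇒≡1 p∣1) pp)
  where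
  -- 5 · 11 · 17 and 29 · 59 · 89.
  p∣1 : p ∣ gcd 935 152279
  p∣1 = gcd-greatest (p∣ 1 (s≤s z≤n)) (p∣ 5 (s≤s z≤n))

linearForms-prime : ∀ k → (∀ i → Primeℤ (linearForm coefficient constant i (8 + k))) →
                    Prime (p₁ k) × Prime (p₂ k) × Prime (p₃ k)
linearForms-prime k primes =
  subst Prime (p₁≡ k) (primes 0F) , subst Prime (p₂≡ k) (primes 1F) , subst Prime (p₃≡ k) (primes 2F)
  where
  -- The left side is what the integer 6(8 + k) - 1 evaluates to: the subtraction removes the
  -- leading successor of 8 + k + 5(8 + k).
  p₁≡ : ∀ k → 7 + k + 5 * (8 + k) ≡ 47 + 6 * k
  p₁≡ = solve-∀
  p₂≡ : ∀ k → 7 + k + 11 * (8 + k) ≡ 95 + 12 * k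
  p₂≡ = solve-∀
  p₃≡ : ∀ k → 7 + k + 17 * (8 + k) ≡ 143 + 18 * k
  p₃≡ = solve-∀

8+k<p₁p₂p₃ : ∀ k → 8 + k < p₁p₂p₃ k
8+k<p₁p₂p₃ k = begin-strict
  8 + k             ≡⟨ cong (8 +_) (*-identityˡ k) ⟨
  8 + 1 * k         <⟨ linear-< 8 1 47 6 k ⟩
  p₁ k              ≤⟨ m≤m*n (p₁ k) (p₂ k) ⟩
  p₁ k * p₂ k       ≤⟨ m≤m*n (p₁ k * p₂ k) (p₃ k) ⟩
  p₁p₂p₃ k          ∎
  where open ≤-Reasoning

distinct : ∀ i j → coefficient i ≡ coefficient j → constant i ≡ constant j → i ≡ j
distinct i j 6[1+i]≡6[1+j] _ = Fin.toℕ-injective (suc-injective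
  (*-cancelˡ-≡ (suc (toℕ i)) (suc (toℕ j)) 6 6[1+i]≡6[1+j]))

theorem4p1 : PrimeKTuplesConjecture →
    ∀ (N : ℕ) → ∃[ n ] N < n × LucasCarmichael n × degree n ≡ 2 × length (primeDivisors n) ≡ 3
theorem4p1 conjecture N =
  -- The bound 8 + N serves twice: m > 8 allows m = 8 + k, and m > N gives n > N.
  go (largePrimeTuples conjecture coefficient constant (λ _ → z<s) (λ _ ()) distinct admissible (8 + N))
  where
  at : ∀ k → N < 8 + k → Prime (p₁ k) × Prime (p₂ k) × Prime (p₃ k) →
       ∃[ n ] N < n × LucasCarmichael n × degree n ≡ 2 × length (primeDivisors n) ≡ 3
  at k N<8+k (pp , pq , pr) = p₁p₂p₃ k , <-trans N<8+k (8+k<p₁p₂p₃ k) , lucasCarmichael-p₁p₂p₃ k pp pq pr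
    , degree-p₁p₂p₃ k pp pq pr , length-primeDivisors-p₁p₂p₃ k pp pq pr

  go : (∃[ m ] 8 + N < m × ∀ i → Primeℤ (linearForm coefficient constant i m)) →
       ∃[ n ] N < n × LucasCarmichael n × degree n ≡ 2 × length (primeDivisors n) ≡ 3
  go (m , 8+N<m , primes) = at (m ∸ 8) (subst (N <_) m≡ (≤-<-trans (m≤n+m N 8) 8+N<m))
      (linearForms-prime (m ∸ 8) (subst (λ m → ∀ i → Primeℤ (linearForm coefficient constant i m)) m≡ primes))
    where
    m≡ : m ≡ 8 + (m ∸ 8)
    m≡ = sym (m+[n∸m]≡n (≤-trans (m≤m+n 8 N) (<⇒≤ 8+N<m)))
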